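{- Let $r\ge1$ and $k$ be integers with $2r+5\le 2k+1\le 3r+1$, and let $C_{2k+1}$ be the cycle on $2k+1$ vertices. Put $q=2k-2r$ (so $2k+1=2r+1+q$), and write $2k+1=lq+m$ where $l\ge 3$ is an integer and $m\in\{0,1,\dots,q-1\}$. Then: (1) if either ($l$ is odd, $m=q-1$ and $2k+1\ge 5q$) or ($l$ is even and $m=1$), then $M_r^I(C_{2k+1})=k+2$; (2) otherwise, $M_r^I(C_{2k+1})=\gcd(q,2k+1)\left\lceil\frac{2k+1}{2\gcd(q,2k+1)}\right\rceil$.
   Context: For a graph $G=(V,E)$ and integer $r\ge1$, $d(x,y)$ is the number of edges in a shortest path between $x$ and $y$, $N_r[x]=\{y\in V: d(x,y)\le r\}$, and for $D\subseteq V$, $D_r(x)=N_r[x]\cap D$. A set $D\subseteq V$ is an $r$-identifying code ($r$-IC) of $G$ if $D_r(x)\neq\emptyset$ for every $x\in V$ and $D_r(x)\neq D_r(y)$ for all distinct $x,y\in V$. $M_r^I(G)$ denotes the minimum cardinality of an $r$-identifying code of $G$. -}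

module Defs where

open import Data.Nat using (ℕ; zero; suc; _+_; _*_; _≤_; NonZero)
open import Data.Nat.DivMod using (_%_; _/_)
open import Data.Fin using (Fin; toℕ)
open import Data.Fin.Subset using (Subset; _∈_; ∣_∣)
open import Data.Product using (Σ; ∃; _×_)
open import Data.Sum using (_⊎_)
open import Relation.Binary.PropositionalEquality using (_≡_; _≢_)
open import Relation.Nullary using (¬_)
open import Function.Bundles using (_⇔_)

CycleAdj : (n : ℕ) → .{{NonZero n}} → Fin n → Fin n → Set
CycleAdj n x y = (toℕ y ≡ suc (toℕ x) % n) ⊎ (toℕ x ≡ suc (toℕ y) % n)

data Walk {n : ℕ} (Adj : Fin n → Fin n → Set) : ℕ → Fin n → Fin n → Set where
  here : ∀ {x} → Walk Adj zero x x
  step : ∀ {j x y z} → Adj x y → Walk Adj j y z → Walk Adj (suc j) x z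

InBall : {n : ℕ} (Adj : Fin n → Fin n → Set) → ℕ → Fin n → Fin n → Set
InBall Adj r x y = ∃ λ j → j ≤ r × Walk Adj j x y

InDr : {n : ℕ} (Adj : Fin n → Fin n → Set) → ℕ → Subset n → Fin n → Fin n → Set
InDr Adj r D x z = z ∈ D × InBall Adj r x z

IsIdentifyingCode : {n : ℕ} (Adj : Fin n → Fin n → Set) → ℕ → Subset n → Set
IsIdentifyingCode {n} Adj r D =
  (∀ (x : Fin n) → ∃ λ z → InDr Adj r D x z)
  × (∀ (x y : Fin n) → x ≢ y → ¬ (∀ (z : Fin n) → InDr Adj r D x z ⇔ InDr Adj r D y z))

IsMinICSize : {n : ℕ} (Adj : Fin n → Fin n → Set) → ℕ → ℕ → Set
IsMinICSize {n} Adj r M =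
  (∃ λ (D : Subset n) → IsIdentifyingCode Adj r D × ∣ D ∣ ≡ M)
  × (∀ (D : Subset n) → IsIdentifyingCode Adj r D → M ≤ ∣ D ∣)

-- ⌈ a / b ⌉ (b > 0); value at b = 0 is irrelevant (never used).
ceilDiv : ℕ → ℕ → ℕ
ceilDiv a zero = zero
ceilDiv a (suc b) = (a + b) / suc b

{-# OPTIONS --safe #-}
-- Write n = 2k+1 = 2r+1+q. The complement of a ball is a run of q consecutive vertices, so comparing the balls around
-- x and x+1 shows that an r-identifying code meets {p, p+q} for all p (it is a vertex cover of the circulant graph
-- with step q). Conversely such a cover can only fail to be identifying if it misses two different runs of q
-- consecutive vertices ("gaps"). The circulant graph consists of g = gcd(q, n) cycles of odd length n/g, which gives
-- the lower bound g⌈n/2g⌉. If g > 1 the g cycles can be covered so that there is no gap at all. If g = 1 the minimum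
-- cover is unique up to rotation, and it has two gaps exactly when n = Lq ± 1 with L even (L ≥ 4 for +, L ≥ 6 for −);
-- then one more vertex suffices.
module Submission where

open import Defs
open import Data.Bool using (Bool; true; false; not; if_then_else_; _∨_; _xor_)
open import Data.Bool.Properties using (not-involutive; not-injective; ∨-zeroʳ)
open import Data.Empty using (⊥; ⊥-elim)
open import Data.Fin using (Fin; toℕ; fromℕ<) renaming (zero to 0F; suc to 1+F)
open import Data.Fin.Permutation using (Permutation; permutation)
open import Data.Fin.Properties using (toℕ-fromℕ<; toℕ-injective; toℕ<n)
open import Data.Fin.Subset using (Subset; ∣_∣; _∈_)
open import Data.List using ([]; _∷_)
open import Data.Nat hiding (parity)
open import Data.Nat.DivMod
open import Data.Nat.Divisibility using (divides)
open import Data.Nat.GCD using (gcd; module GCD; GCD; gcd-GCD; module Bézout; gcd[m,n]≡0⇒n≡0)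
open import Data.Nat.Properties
open import Data.Nat.Tactic.RingSolver using (solve)
open import Data.Product using (∃; _×_; _,_; proj₁; proj₂)
open import Data.Sum using (_⊎_; inj₁; inj₂)
open import Data.Vec using (lookup; tabulate) renaming ([] to []ᵛ; _∷_ to _∷ᵛ_)
open import Data.Vec.Properties using (lookup∘tabulate; lookup⇒[]=; []=⇒lookup)
open import Function using (_∘_; _∋_)
open import Function.Bundles using (mk⇔; Equivalence)
open import Relation.Binary.PropositionalEquality using (_≡_; _≢_; refl; sym; trans; cong; cong₂; subst; subst₂; module ≡-Reasoning)
open import Relation.Nullary using (¬_; yes; no; does; contradiction)
open import Relation.Nullary.Decidable using (dec-true; dec-false)
import Algebra.Properties.CommutativeMonoid.Sum +-0-commutativeMonoid as FinSum

-- Vertices at cyclic distance at most q are separated because their balls differ in two vertices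
-- that are q apart modulo n, and a cover keeps one of them; this rests on q ≤ r, that is n ≤ 3r +
-- 1. At larger distance the complements of the two balls are disjoint, so equal traces turn both
-- complements into gaps. The exceptions arise as follows. If g = 1, multiplication by an inverse w
-- of ±q turns the circulant graph into the n-cycle and a gap into a progression of q terms with
-- step w. A minimum cover of the odd cycle misses exactly a progression of k terms with step 2. For
-- even w, a gap and its translate by 2 both fit into it exactly when 2 + (q - 1)w < n - 1. Together
-- with w < n this keeps w q below 2n, and since w q is ±1 modulo n, only w q = n ± 1 remains. For w
-- q = n + 1 the inequality says w ≥ 5, hence w ≥ 6 by evenness; as l = w - 1 there, this is the
-- condition 5q ≤ n, which excludes n = 4q - 1.

-- Farkas certificates for linear arithmetic: L ≤ R is a sum of hypotheses, s is the slack,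
-- and the remaining ring identity is left to the solver.
≤-certificate : ∀ {a b L R} s → L ≤ R → R + a + s ≡ L + b → a ≤ b
≤-certificate {a} {b} {L} {R} s L≤R eq =
  +-cancelˡ-≤ R a b (≤-trans (m≤m+n (R + a) s) (≤-trans (≤-reflexive eq) (+-monoˡ-≤ b L≤R)))

≡-certificate : ∀ {a b L R : ℕ} → L ≡ R → R + a ≡ L + b → a ≡ b
≡-certificate {a} {b} {L} refl eq = +-cancelˡ-≡ L a b eq

≤-refute : ∀ {L R} s → L ≤ R → R + suc s ≡ L → ⊥
≤-refute {R = R} s L≤R refl = m+1+n≰m R L≤R

-- Congruence of natural numbers

-- Multiples of n are allowed on both sides, so no subtraction occurs and the laws below become ring
-- identities for the solver.
record _≈_[mod_] (a b n : ℕ) : Set where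
  constructor shift
  field
    x y : ℕ
    eq  : a + x * n ≡ b + y * n

infix 4 _≈_[mod_]

module Congruence {n : ℕ} where

  ≈-refl : ∀ {a} → a ≈ a [mod n ]
  ≈-refl = shift 0 0 refl

  ≈-sym : ∀ {a b} → a ≈ b [mod n ] → b ≈ a [mod n ]
  ≈-sym (shift x y eq) = shift y x (sym eq)

  ≈-trans : ∀ {a b c} → a ≈ b [mod n ] → b ≈ c [mod n ] → a ≈ c [mod n ]
  ≈-trans {a} {b} {c} (shift x y eq) (shift x′ y′ eq′) = shift (x + x′) (y + y′)
    (≡-certificate (cong₂ _+_ eq eq′) (solve (a ∷ b ∷ c ∷ x ∷ y ∷ x′ ∷ y′ ∷ n ∷ [])))

  ≡⇒≈ : ∀ {a b} → a ≡ b → a ≈ b [mod n ]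
  ≡⇒≈ refl = ≈-refl

  suc-cong-≈ : ∀ {a b} → a ≈ b [mod n ] → suc a ≈ suc b [mod n ]
  suc-cong-≈ (shift x y eq) = shift x y (cong suc eq)

  +-congʳ-≈ : ∀ {a b} c → a ≈ b [mod n ] → a + c ≈ b + c [mod n ]
  +-congʳ-≈ {a} {b} c (shift x y eq) = shift x y
    (≡-certificate eq (solve (a ∷ b ∷ c ∷ x ∷ y ∷ n ∷ [])))

  +-cancelʳ-≈ : ∀ {a b} c → a + c ≈ b + c [mod n ] → a ≈ b [mod n ]
  +-cancelʳ-≈ {a} {b} c (shift x y eq) = shift x y
    (≡-certificate eq (solve (a ∷ b ∷ c ∷ x ∷ y ∷ n ∷ [])))

  *-congˡ-≈ : ∀ {a b} c → a ≈ b [mod n ] → c * a ≈ c * b [mod n ]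
  *-congˡ-≈ {a} {b} c (shift x y eq) = shift (c * x) (c * y)
    (≡-certificate (cong (c *_) eq) (solve (a ∷ b ∷ c ∷ x ∷ y ∷ n ∷ [])))

  %-≈ : ∀ a .{{_ : NonZero n}} → a % n ≈ a [mod n ]
  %-≈ a = shift (a / n) 0 (trans (sym (m≡m%n+[m/n]*n a n)) (sym (+-identityʳ a)))

  ≈⇒%≡ : ∀ {a b} .{{_ : NonZero n}} → a ≈ b [mod n ] → a % n ≡ b % n
  ≈⇒%≡ {a} {b} (shift x y eq) =
    trans (sym ([m+kn]%n≡m%n a x n)) (trans (cong (_% n) eq) ([m+kn]%n≡m%n b y n))

  ≈⇒≡ : ∀ {a b} .{{_ : NonZero n}} → a < n → b < n → a ≈ b [mod n ] → a ≡ b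
  ≈⇒≡ a<n b<n a≈b = trans (sym (m<n⇒m%n≡m a<n)) (trans (≈⇒%≡ a≈b) (m<n⇒m%n≡m b<n))

open Congruence public

difference : ∀ {n} .{{_ : NonZero n}} a b → ∃ λ d → d < n × (a + d ≈ b [mod n ])
-- The term `a * N` stands for -a, because N is -1 modulo `suc N`.
difference {suc N} a b = (b + a * N) % suc N , m%n<n (b + a * N) (suc N) ,
  ≈-trans (≡⇒≈ (+-comm a _)) (≈-trans (+-congʳ-≈ a (%-≈ (b + a * N))) (shift 0 a (solve (a ∷ b ∷ N ∷ []))))

Periodic : {A : Set} → ℕ → (ℕ → A) → Set
Periodic n f = ∀ a → f (a + n) ≡ f a

module _ {A : Set} {n : ℕ} {f : ℕ → A} (per : Periodic n f) where

  periodic-+* : ∀ a x → f (a + x * n) ≡ f a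
  periodic-+* a zero    = cong f (+-identityʳ a)
  periodic-+* a (suc x) = trans (cong f ((a + (n + x * n) ≡ a + x * n + n)
      ∋ solve (a ∷ x ∷ n ∷ []))) (trans (per (a + x * n)) (periodic-+* a x))

  periodic-≈ : ∀ {a b} → a ≈ b [mod n ] → f a ≡ f b
  periodic-≈ {a} {b} (shift x y eq) =
    trans (sym (periodic-+* a x)) (trans (cong f eq) (periodic-+* b y))

  periodic-shift : ∀ s → Periodic n (λ a → f (a + s))
  periodic-shift s a = trans (cong f ((a + n + s ≡ a + s + n) ∋ solve (a ∷ n ∷ s ∷ []))) (per (a + s))

  periodic-scale : ∀ w → Periodic n (λ a → f (w * a))
  periodic-scale w a = trans (cong f (*-distribˡ-+ w a n)) (periodic-+* (w * a) w)

periodic-% : {A : Set} {n : ℕ} .{{_ : NonZero n}} (f : ℕ → A) → Periodic n (λ i → f (i % n))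
periodic-% {n = n} f a = cong f ([m+n]%n≡m%n a n)

-- Finite sums

∑ : ℕ → (ℕ → ℕ) → ℕ
∑ zero    f = 0
∑ (suc n) f = f 0 + ∑ n (f ∘ suc)

⟦_⟧ : Bool → ℕ
⟦ true ⟧  = 1
⟦ false ⟧ = 0

count : ℕ → (ℕ → Bool) → ℕ
count n f = ∑ n (λ i → ⟦ f i ⟧)

∑-cong : ∀ n {f g : ℕ → ℕ} → (∀ i → i < n → f i ≡ g i) → ∑ n f ≡ ∑ n g
∑-cong zero    eq = refl
∑-cong (suc n) eq = cong₂ _+_ (eq 0 z<s) (∑-cong n (λ i i<n → eq (suc i) (s<s i<n)))

∑-mono : ∀ n {f g : ℕ → ℕ} → (∀ i → i < n → f i ≤ g i) → ∑ n f ≤ ∑ n g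
∑-mono zero    le = z≤n
∑-mono (suc n) le = +-mono-≤ (le 0 z<s) (∑-mono n (λ i i<n → le (suc i) (s<s i<n)))

∑-const : ∀ n c → ∑ n (λ _ → c) ≡ n * c
∑-const zero    c = refl
∑-const (suc n) c = cong (c +_) (∑-const n c)

∑-distrib-+ : ∀ n f g → ∑ n (λ i → f i + g i) ≡ ∑ n f + ∑ n g
∑-distrib-+ zero    f g = refl
∑-distrib-+ (suc n) f g = trans (cong (f 0 + g 0 +_) (∑-distrib-+ n (f ∘ suc) (g ∘ suc)))
  (exchange (f 0) (g 0) (∑ n (f ∘ suc)) (∑ n (g ∘ suc)))
  where
  exchange : ∀ a b c d → (a + b) + (c + d) ≡ (a + c) + (b + d)
  exchange a b c d = solve (a ∷ b ∷ c ∷ d ∷ [])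

∑-split : ∀ m n f → ∑ (m + n) f ≡ ∑ m f + ∑ n (λ i → f (m + i))
∑-split zero    n f = refl
∑-split (suc m) n f = trans (cong (f 0 +_) (∑-split m n (f ∘ suc))) (sym (+-assoc (f 0) _ _))

∑-last : ∀ n f → ∑ (suc n) f ≡ ∑ n f + f n
∑-last n f = begin
  ∑ (suc n) f               ≡⟨ cong (λ m → ∑ m f) (+-comm 1 n) ⟩
  ∑ (n + 1) f               ≡⟨ ∑-split n 1 f ⟩
  ∑ n f + (f (n + 0) + 0)   ≡⟨ cong (∑ n f +_) (trans (+-identityʳ _) (cong f (+-identityʳ n))) ⟩
  ∑ n f + f n               ∎
  where open ≡-Reasoning

∑-pairs : ∀ n f → ∑ (n * 2) f ≡ ∑ n (λ i → f (i * 2) + f (suc (i * 2)))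
∑-pairs zero    f = refl
∑-pairs (suc n) f = trans (sym (+-assoc (f 0) (f 1) _)) (cong (f 0 + f 1 +_) (∑-pairs n (f ∘ suc ∘ suc)))

∑-swap : ∀ m n (f : ℕ → ℕ → ℕ) → ∑ m (λ i → ∑ n (f i)) ≡ ∑ n (λ j → ∑ m (λ i → f i j))
∑-swap zero    n f = sym (trans (∑-const n 0) (*-zeroʳ n))
∑-swap (suc m) n f = trans (cong (∑ n (f 0) +_) (∑-swap m n (f ∘ suc)))
  (sym (∑-distrib-+ n (f 0) (λ j → ∑ m (λ i → f (suc i) j))))

∑-blocks : ∀ g m f → ∑ (m * g) f ≡ ∑ m (λ i → ∑ g (λ c → f (c + i * g)))
∑-blocks g zero    f = refl
∑-blocks g (suc m) f = trans (∑-split g (m * g) f)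
  (cong₂ _+_ (∑-cong g (λ c _ → cong f (sym (+-identityʳ c))))
    (trans (∑-blocks g m (λ j → f (g + j)))
      (∑-cong m (λ i _ → ∑-cong g (λ c _ → cong f ((g + (c + i * g) ≡ c + (g + i * g)) ∋ solve (g ∷ c ∷ i ∷ [])))))))

∑-≤-pointwise : ∀ n {f g : ℕ → ℕ} → (∀ i → i < n → f i ≤ g i) → ∑ n g ≤ ∑ n f → ∀ i → i < n → f i ≡ g i
∑-≤-pointwise (suc n) {f} {g} le tot = λ
  { zero    _         → ≤-antisym (le 0 z<s) (≤-certificate 0 (+-mono-≤ tot rest) (exchange₁ (f 0) (g 0) (∑ n (f ∘ suc)) (∑ n (g ∘ suc))))
  ; (suc i) (s<s i<n) → ∑-≤-pointwise n (λ i i<n → le (suc i) (s<s i<n))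
      (≤-certificate 0 (+-mono-≤ tot (le 0 z<s)) (exchange₂ (f 0) (g 0) (∑ n (f ∘ suc)) (∑ n (g ∘ suc)))) i i<n }
  where
  rest : ∑ n (f ∘ suc) ≤ ∑ n (g ∘ suc)
  rest = ∑-mono n (λ i i<n → le (suc i) (s<s i<n))
  exchange₁ : ∀ a b c d → (a + c) + d + b + 0 ≡ (b + d) + c + a
  exchange₁ a b c d = solve (a ∷ b ∷ c ∷ d ∷ [])
  exchange₂ : ∀ a b c d → (a + c) + b + d + 0 ≡ (b + d) + a + c
  exchange₂ a b c d = solve (a ∷ b ∷ c ∷ d ∷ [])

module _ {n : ℕ} {h : ℕ → ℕ} (per : Periodic n h) where

  ∑-shift₁ : ∑ n (h ∘ suc) ≡ ∑ n h
  ∑-shift₁ = +-cancelˡ-≡ (h 0) _ _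
    (trans (∑-last n h) (trans (cong (∑ n h +_) (per 0)) (+-comm (∑ n h) (h 0))))

∑-shift : ∀ {n} {h : ℕ → ℕ} → Periodic n h → ∀ s → ∑ n (λ i → h (i + s)) ≡ ∑ n h
∑-shift {n} {h} per zero    = ∑-cong n (λ i _ → cong h (+-identityʳ i))
∑-shift {n} {h} per (suc s) = trans (∑-cong n (λ i _ → cong h (+-suc i s)))
  (trans (∑-shift₁ {n} {λ i → h (i + s)} (periodic-shift per s)) (∑-shift per s))

∑-toFin : ∀ n h → ∑ n h ≡ FinSum.sum {n} (h ∘ toℕ)
∑-toFin zero    h = refl
∑-toFin (suc n) h = cong (h 0 +_) (∑-toFin n (h ∘ suc))

toℕ-mod : ∀ a {n} .{{_ : NonZero n}} → toℕ (a mod n) ≡ a % n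
toℕ-mod a {n} = toℕ-fromℕ< (m%n<n a n)

-- Multiplication by a unit permutes the residues.
∑-scale : ∀ {n} .{{_ : NonZero n}} {h : ℕ → ℕ} → Periodic n h →
          ∀ w v → w * v ≈ 1 [mod n ] → ∑ n (λ i → h (w * i)) ≡ ∑ n h
∑-scale {n} {h} per w v wv≈1 = sym (begin
  ∑ n h                                        ≡⟨ ∑-toFin n h ⟩
  FinSum.sum {n} (h ∘ toℕ)                     ≡⟨ FinSum.sum-permute (h ∘ toℕ) π ⟩
  FinSum.sum {n} (λ i → h (toℕ (mul w i)))     ≡⟨ FinSum.sum-cong-≗ {n} (λ i → periodic-≈ per (mul-≈ w i)) ⟩
  FinSum.sum {n} (λ i → h (w * toℕ i))         ≡⟨ ∑-toFin n (λ i → h (w * i)) ⟨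
  ∑ n (λ i → h (w * i))                        ∎)
  where
  open ≡-Reasoning
  mul : ℕ → Fin n → Fin n
  mul u i = (u * toℕ i) mod n
  mul-≈ : ∀ u i → toℕ (mul u i) ≈ u * toℕ i [mod n ]
  mul-≈ u i = ≈-trans (≡⇒≈ (toℕ-mod (u * toℕ i))) (%-≈ (u * toℕ i))
  rearrange : ∀ u u′ i → u * (u′ * i) ≡ i * (u * u′)
  rearrange u u′ i = solve (u ∷ u′ ∷ i ∷ [])
  inverse : ∀ u u′ → u * u′ ≈ 1 [mod n ] → ∀ i → mul u (mul u′ i) ≡ i
  inverse u u′ uu′≈1 i = toℕ-injective (≈⇒≡ (toℕ<n _) (toℕ<n i)
    (≈-trans (mul-≈ u _) (≈-trans (*-congˡ-≈ u (mul-≈ u′ i)) (≈-trans (≡⇒≈ (rearrange u u′ (toℕ i)))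
      (≈-trans (*-congˡ-≈ (toℕ i) uu′≈1) (≡⇒≈ (*-identityʳ (toℕ i))))))))
  π : Permutation n n
  π = permutation (mul w) (mul v) (inverse w v wv≈1) (inverse v w (≈-trans (≡⇒≈ (*-comm v w)) wv≈1))

∣∣≡count : ∀ {n} (D : Subset n) (f : ℕ → Bool) → (∀ i → lookup D i ≡ f (toℕ i)) → ∣ D ∣ ≡ count n f
∣∣≡count []ᵛ         f eq = refl
∣∣≡count (true ∷ᵛ D)  f eq rewrite sym (eq 0F) = cong suc (∣∣≡count D (f ∘ suc) (eq ∘ 1+F))
∣∣≡count (false ∷ᵛ D) f eq rewrite sym (eq 0F) = ∣∣≡count D (f ∘ suc) (eq ∘ 1+F)

≡true? : ∀ b → b ≡ true ⊎ b ≡ false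
≡true? true  = inj₁ refl
≡true? false = inj₂ refl

-- Covers and gaps; balls of the cycle as runs of consecutive vertices

Cover : ℕ → (ℕ → Bool) → Set
Cover q f = ∀ p → f p ≡ false → f (p + q) ≡ true

Gap : ℕ → (ℕ → Bool) → ℕ → Set
Gap q f a = ∀ t → t < q → f (a + t) ≡ false

UniqueGap : ℕ → ℕ → (ℕ → Bool) → Set
UniqueGap n q f = ∀ a b → Gap q f a → Gap q f b → a ≈ b [mod n ]

module Ball (r n : ℕ) .{{_ : NonZero n}} where

  Adj : Fin n → Fin n → Set
  Adj = CycleAdj n

  -- z lies in {x−r, …, x+r}
  Near : ℕ → ℕ → Set
  Near x z = ∃ λ s → s ≤ 2 * r × (x + s ≈ z + r [mod n ])

  Near-resp : ∀ {x x′ z z′} → x ≈ x′ [mod n ] → z ≈ z′ [mod n ] → Near x z → Near x′ z′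
  Near-resp x≈ z≈ (s , s≤ , e) =
    s , s≤ , ≈-trans (≈-sym (+-congʳ-≈ s x≈)) (≈-trans e (+-congʳ-≈ r z≈))

  -- Here s is the signed displacement plus the number of steps, which keeps it natural: a forward
  -- step adds 2 to it, a backward step adds 0.
  walk⇒ : ∀ {j x z} → Walk Adj j x z → ∃ λ s → s ≤ 2 * j × (toℕ x + s ≈ toℕ z + j [mod n ])
  walk⇒ here = 0 , z≤n , ≈-refl
  walk⇒ {suc j} {x} {z} (step {y = y} adj w) with walk⇒ w | adj
  ... | s , s≤ , e | inj₁ y≡ = suc (suc s) ,
        ≤-certificate 0 s≤ (solve (s ∷ j ∷ [])) ,
        ≈-trans (≡⇒≈ (regroup (toℕ x) s))
          (≈-trans (+-congʳ-≈ 1 (≈-trans (+-congʳ-≈ s (≈-sym (≈-trans (≡⇒≈ y≡) (%-≈ (suc (toℕ x)))))) e))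
            (≡⇒≈ (trans (+-comm _ 1) (sym (+-suc (toℕ z) j)))))
    where
    regroup : ∀ a b → a + suc (suc b) ≡ suc a + b + 1
    regroup a b = solve (a ∷ b ∷ [])
  ... | s , s≤ , e | inj₂ x≡ = s ,
        ≤-certificate 2 s≤ (solve (s ∷ j ∷ [])) ,
        ≈-trans (+-congʳ-≈ s (≈-trans (≡⇒≈ x≡) (%-≈ (suc (toℕ y)))))
          (≈-trans (≡⇒≈ (+-comm 1 (toℕ y + s))) (≈-trans (+-congʳ-≈ 1 e)
            (≡⇒≈ (trans (+-comm _ 1) (sym (+-suc (toℕ z) j))))))

  toℕ-mod-≈ : ∀ a → toℕ (a mod n) ≈ a [mod n ]
  toℕ-mod-≈ a = ≈-trans (≡⇒≈ (toℕ-mod a)) (%-≈ a)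

  toℕ-injective-≈ : ∀ {x y : Fin n} → toℕ x ≈ toℕ y [mod n ] → x ≡ y
  toℕ-injective-≈ {x} {y} e = toℕ-injective (≈⇒≡ (toℕ<n x) (toℕ<n y) e)

  ascend : ∀ s (x z : Fin n) → toℕ x + s ≈ toℕ z [mod n ] → Walk Adj s x z
  ascend zero x z e with refl ← toℕ-injective-≈ {x} {z} (≈-trans (≡⇒≈ (sym (+-identityʳ _))) e) = here
  ascend (suc s) x z e = step {y = suc (toℕ x) mod n} (inj₁ (toℕ-mod (suc (toℕ x))))
    (ascend s (suc (toℕ x) mod n) z (≈-trans (+-congʳ-≈ s (toℕ-mod-≈ (suc (toℕ x))))
      (≈-trans (≡⇒≈ (sym (+-suc (toℕ x) s))) e)))

  predecessor : ∀ (x : Fin n) → ∃ λ (y : Fin n) → toℕ x ≡ suc (toℕ y) % n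
  predecessor x with d , d<n , e ← difference {n} 1 (toℕ x) = fromℕ< d<n ,
    sym (trans (cong (λ i → suc i % n) (toℕ-fromℕ< d<n)) (trans (≈⇒%≡ e) (m<n⇒m%n≡m (toℕ<n x))))

  descend : ∀ s (x z : Fin n) → toℕ z + s ≈ toℕ x [mod n ] → Walk Adj s x z
  descend zero x z e with refl ← toℕ-injective-≈ {z} {x} (≈-trans (≡⇒≈ (sym (+-identityʳ _))) e) = here
  descend (suc s) x z e with y , x≡ ← predecessor x = step {y = y} (inj₂ x≡)
    (descend s y z (+-cancelʳ-≈ 1 (≈-trans (≡⇒≈ (trans (+-comm _ 1) (sym (+-suc (toℕ z) s))))
      (≈-trans e (≈-trans (≈-trans (≡⇒≈ x≡) (%-≈ (suc (toℕ y)))) (≡⇒≈ (+-comm 1 (toℕ y))))))))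

  InBall⇒Near : ∀ {x z} → InBall Adj r x z → Near (toℕ x) (toℕ z)
  InBall⇒Near {x} {z} (j , j≤r , w) with walk⇒ w | m≤n⇒∃[o]m+o≡n j≤r
  ... | s , s≤ , e | o , refl = s + o , ≤-certificate o s≤ (solve (s ∷ j ∷ o ∷ [])) ,
    ≈-trans (≡⇒≈ (sym (+-assoc (toℕ x) s o))) (≈-trans (+-congʳ-≈ o e) (≡⇒≈ (+-assoc (toℕ z) j o)))

  Near⇒InBall : ∀ {x z} → Near (toℕ x) (toℕ z) → InBall Adj r x z
  Near⇒InBall {x} {z} (s , s≤ , e) with ≤-total r s
  ... | inj₁ r≤s with o , refl ← m≤n⇒∃[o]m+o≡n r≤s = o , +-cancelˡ-≤ r o r (≤-trans s≤ (≤-reflexive (solve (r ∷ [])))) ,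
    ascend o x z (+-cancelʳ-≈ r (≈-trans (≡⇒≈ (regroup (toℕ x) r o)) e))
    where
    regroup : ∀ a b c → a + c + b ≡ a + (b + c)
    regroup a b c = solve (a ∷ b ∷ c ∷ [])
  ... | inj₂ s≤r with o , s+o≡r ← m≤n⇒∃[o]m+o≡n s≤r = o , ≤-trans (m≤n+m o s) (≤-reflexive s+o≡r) ,
    descend o x z (+-cancelʳ-≈ s (≈-trans (≡⇒≈ (trans (regroup (toℕ z) s o) (cong (toℕ z +_) s+o≡r))) (≈-sym e)))
    where
    regroup : ∀ a b c → a + c + b ≡ a + (b + c)
    regroup a b c = solve (a ∷ b ∷ c ∷ [])

-- Separation of vertices in terms of covers and gaps

module Cycle (r q : ℕ) where

  n : ℕ
  n = suc (2 * r + q)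

  open Ball r n public

  ¬Near : ∀ {x z} s → 2 * r < s → s < n → x + s ≈ z + r [mod n ] → ¬ Near x z
  ¬Near {x} {z} s 2r<s s<n e (s′ , s′≤ , e′) = <⇒≱ 2r<s (subst (_≤ 2 * r) (sym s≡s′) s′≤)
    where
    s≡s′ : s ≡ s′
    s≡s′ = ≈⇒≡ s<n (s≤s (≤-trans s′≤ (m≤m+n (2 * r) q)))
      (+-cancelʳ-≈ x (≈-trans (≡⇒≈ (+-comm s x)) (≈-trans e (≈-trans (≈-sym e′) (≡⇒≈ (+-comm x s′))))))

  near-or-opposite : ∀ x z → Near x z ⊎ ∃ λ t → t < q × (z ≈ x + suc r + t [mod n ])
  near-or-opposite x z with s , s<n , e ← difference {n} x (z + r) with s ≤? 2 * r
  ... | yes s≤ = inj₁ (s , s≤ , e)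
  ... | no s≰ with t , refl ← m≤n⇒∃[o]m+o≡n (≰⇒> s≰) = inj₂ (t , +-cancelˡ-≤ (2 * r) (suc t) q
        (≤-trans (≤-reflexive (+-suc (2 * r) t)) (s≤s⁻¹ s<n)) ,
        +-cancelʳ-≈ r (≈-trans (≈-sym e) (≡⇒≈ ((x + (suc (2 * r) + t) ≡ x + suc r + t + r) ∋ solve (x ∷ r ∷ t ∷ [])))))

  module Code (f : ℕ → Bool) (per : Periodic n f) where

    -- D_r(x) ⊆ D_r(y)
    _⊑_ : ℕ → ℕ → Set
    x ⊑ y = ∀ z → f z ≡ true → Near x z → Near y z

    Separating : Set
    Separating = ∀ x y → x ⊑ y → y ⊑ x → x ≈ y [mod n ]

    separating⇒cover : 1 ≤ q → Separating → Cover q f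
    separating⇒cover 1≤q sep p fp with ≡true? (f (p + q))
    ... | inj₁ t = t
    ... | inj₂ fpq = contradiction
          (≈⇒≡ {n} (s≤s z≤n) (s≤s (≤-trans 1≤q (m≤n+m q (2 * r))))
            (+-cancelʳ-≈ x (sep x (suc x) there back))) λ ()
      where
      -- The balls around x and x + 1 differ only in x - r, which is p + q, and in x + r + 1 = p +
      -- n, which is p modulo n.
      x : ℕ
      x = p + r + q
      there : x ⊑ suc x
      there z fz (zero , _ , e) = contradiction (trans (sym fpq) (trans (periodic-≈ per
        (+-cancelʳ-≈ r (≈-trans (≡⇒≈ ((p + q + r ≡ p + r + q + 0) ∋ solve (p ∷ q ∷ r ∷ []))) e))) fz)) λ ()
      there z fz (suc s , s< , e) = s , ≤-trans (n≤1+n s) s< , ≈-trans (≡⇒≈ (sym (+-suc x s))) e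
      back : suc x ⊑ x
      back z fz (s , s≤ , e) with m≤n⇒m<n∨m≡n s≤
      ... | inj₁ s< = suc s , s< , ≈-trans (≡⇒≈ (+-suc x s)) e
      ... | inj₂ refl = contradiction (trans (sym fp) (trans (periodic-≈ per
        (+-cancelʳ-≈ r (≈-trans (shift 1 0 ((p + r + 1 * suc (2 * r + q) ≡ suc (p + r + q) + 2 * r + 0 * suc (2 * r + q))
            ∋ solve (p ∷ q ∷ r ∷ []))) e))) fz)) λ ()

    -- A gap at a is the complement of the ball around `a + (r + q)`, since adding r + 1 to that
    -- centre gives a + n. Two gaps therefore give two centres that both see the whole code.
    separating⇒uniqueGap : Separating → UniqueGap n q f
    separating⇒uniqueGap sep a b gapA gapB =
      +-cancelʳ-≈ (r + q) (sep _ _ (λ z fz _ → everything b gapB z fz) (λ z fz _ → everything a gapA z fz))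
      where
      everything : ∀ a → Gap q f a → ∀ z → f z ≡ true → Near (a + (r + q)) z
      everything a gap z fz with near-or-opposite (a + (r + q)) z
      ... | inj₁ near = near
      ... | inj₂ (t , t<q , e) = contradiction (trans (sym (gap t t<q)) (trans (periodic-≈ per
            (≈-sym (≈-trans e (shift 0 1 ((a + (r + q) + suc r + t + 0 * suc (2 * r + q) ≡ a + t + 1 * suc (2 * r + q))
                ∋ solve (a ∷ r ∷ q ∷ t ∷ [])))))) fz)) λ ()

    -- Counted from the left end of the ball of x, this vertex has offset 2r + 1 + t, outside the
    -- ball because t < q. Counted from that of y the offset is 2r + 1 + t - d, which the two bounds
    -- on d place between 0 and 2r. So y would see it and x would not.
    opposite-false : ∀ {x y} d → x ⊑ y → y ⊑ x → x + d ≈ y [mod n ] →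
                     ∀ t → t < q → t < d → d ≤ suc (2 * r + t) → f (x + suc r + t) ≡ false
    opposite-false {x} {y} d x⊑y y⊑x e t t<q t<d d≤ with ≡true? (f (x + suc r + t)) | m≤n⇒∃[o]m+o≡n d≤
    ... | inj₂ fz | _ = fz
    ... | inj₁ fz | o , d+o≡ = ⊥-elim (¬Near (suc (2 * r + t)) (s≤s (m≤m+n (2 * r) t))
            (s≤s (≤-trans (≤-reflexive (sym (+-suc (2 * r) t))) (+-monoʳ-≤ (2 * r) t<q)))
            (≡⇒≈ ((x + suc (2 * r + t) ≡ x + suc r + t + r) ∋ solve (x ∷ r ∷ t ∷ [])))
            (y⊑x (x + suc r + t) fz (o , ≤-certificate 0 (+-mono-≤ t<d (≤-reflexive d+o≡)) (solve (t ∷ d ∷ o ∷ r ∷ [])) ,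
              ≈-trans (+-congʳ-≈ o (≈-sym e)) (≡⇒≈ (trans (+-assoc x d o) (trans (cong (x +_) d+o≡)
                ((x + suc (2 * r + t) ≡ x + suc r + t + r) ∋ solve (x ∷ r ∷ t ∷ []))))))))

    -- The vertex x + r + 1 lies only in the ball of y, and x - r only in the ball of x. Since x - r
    -- is (x + r + 1) + q modulo n, a cover contains one of the two. The second is reached by going
    -- from y to x the long way round, over the distance `d′` = n - d.
    not-close : q ≤ r → Cover q f → ∀ {x y} d → x ⊑ y → y ⊑ x → x + d ≈ y [mod n ] → 0 < d → d ≤ q → ⊥
    not-close q≤r cover {x} {y} d x⊑y y⊑x e 0<d d≤q with o , d+o≡q ← m≤n⇒∃[o]m+o≡n d≤q =
      contradiction (trans (sym (cover (x + suc r) front)) (trans (periodic-≈ per aligned) back)) λ ()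
      where
      d′ : ℕ
      d′ = suc (2 * r + o)
      y+d′≈x : y + d′ ≈ x [mod n ]
      y+d′≈x = ≈-trans (+-congʳ-≈ d′ (≈-sym e)) (shift 0 1
        (≡-certificate d+o≡q ((q + (x + d + suc (2 * r + o) + 0 * suc (2 * r + q)) ≡ d + o + (x + 1 * suc (2 * r + q)))
            ∋ solve (x ∷ d ∷ r ∷ o ∷ q ∷ []))))
      front : f (x + suc r) ≡ false
      front = trans (cong f (sym (+-identityʳ _))) (opposite-false d x⊑y y⊑x e 0 (≤-trans 0<d d≤q) 0<d
        (≤-certificate (suc r) (+-mono-≤ d≤q q≤r) (solve (d ∷ q ∷ r ∷ []))))
      back : f (y + suc r + o) ≡ false
      back = opposite-false d′ y⊑x x⊑y y+d′≈x o (≤-certificate 0 (+-mono-≤ 0<d (≤-reflexive d+o≡q)) (solve (d ∷ o ∷ q ∷ [])))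
        (s≤s (m≤n+m o (2 * r))) ≤-refl
      aligned : x + suc r + q ≈ y + suc r + o [mod n ]
      aligned = ≈-trans (≡⇒≈ (trans (cong (x + suc r +_) (sym d+o≡q)) ((x + suc r + (d + o) ≡ x + d + (suc r + o))
          ∋ solve (x ∷ r ∷ d ∷ o ∷ []))))
        (≈-trans (+-congʳ-≈ (suc r + o) e) (≡⇒≈ (sym (+-assoc y (suc r) o))))

    -- When d and n - d both exceed q, the complements of the two balls are disjoint, so each lies
    -- in the other ball. Equal traces leave both without code elements: they are gaps at x + r + 1
    -- and y + r + 1, and uniqueness identifies x with y.
    cover∧uniqueGap⇒separating : q ≤ r → Cover q f → UniqueGap n q f → Separating
    cover∧uniqueGap⇒separating q≤r cover unique x y x⊑y y⊑x with d , d<n , e ← difference {n} x y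
      with m≤n⇒∃[o]m+o≡n d<n
    ... | o , 1+d+o≡n with d
    ...   | zero = ≈-trans (≡⇒≈ (sym (+-identityʳ x))) e
    ...   | d@(suc _) = split
      where
      d′ : ℕ
      d′ = suc o
      y+d′≈x : y + d′ ≈ x [mod n ]
      y+d′≈x = ≈-trans (+-congʳ-≈ d′ (≈-sym e)) (shift 0 1
        (≡-certificate 1+d+o≡n (ident d)))
        where
        ident : ∀ d → suc (2 * r + q) + (x + d + suc o + 0 * suc (2 * r + q)) ≡ suc d + o + (x + 1 * suc (2 * r + q))
        ident d = solve (x ∷ d ∷ r ∷ o ∷ q ∷ [])
      bound : ∀ d d′ → d + d′ ≤ suc (2 * r + q) → q < d → d′ ≤ 2 * r
      bound d d′ le q<d = ≤-certificate 0 (+-mono-≤ le q<d) (solve (d ∷ d′ ∷ r ∷ q ∷ []))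
      d+d′≡n : d + d′ ≡ n
      d+d′≡n = trans (+-suc d o) 1+d+o≡n
      split : x ≈ y [mod n ]
      split with d ≤? q | d′ ≤? q
      ... | yes d≤q | _ = ⊥-elim (not-close q≤r cover d x⊑y y⊑x e z<s d≤q)
      ... | no _ | yes d′≤q = ⊥-elim (not-close q≤r cover d′ y⊑x x⊑y y+d′≈x z<s d′≤q)
      ... | no d≰q | no d′≰q = +-cancelʳ-≈ (suc r) (unique _ _
        (λ t t<q → opposite-false d x⊑y y⊑x e t t<q (<-trans t<q (≰⇒> d≰q))
          (≤-trans (bound d′ d (≤-reflexive (trans (+-comm d′ d) d+d′≡n)) (≰⇒> d′≰q)) (≤-trans (m≤m+n (2 * r) t) (n≤1+n _))))
        (λ t t<q → opposite-false d′ y⊑x x⊑y y+d′≈x t t<q (<-trans t<q (≰⇒> d′≰q))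
          (≤-trans (bound d d′ (≤-reflexive d+d′≡n) (≰⇒> d≰q)) (≤-trans (m≤m+n (2 * r) t) (n≤1+n _)))))

    module Membership (D : Subset n) (char : ∀ z → lookup D z ≡ f (toℕ z)) where

      ∈⇒true : ∀ {z} → z ∈ D → f (toℕ z) ≡ true
      ∈⇒true {z} z∈D = trans (sym (char z)) ([]=⇒lookup z∈D)

      true⇒∈ : ∀ {z} → f (toℕ z) ≡ true → z ∈ D
      true⇒∈ {z} fz = lookup⇒[]= z D (trans (char z) fz)

      ⊑⇒InDr : ∀ {x y} → toℕ x ⊑ toℕ y → ∀ z → InDr Adj r D x z → InDr Adj r D y z
      ⊑⇒InDr x⊑y z (z∈D , ball) = z∈D , Near⇒InBall (x⊑y (toℕ z) (∈⇒true z∈D) (InBall⇒Near ball))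

      InDr⇒⊑ : ∀ {x y} → (∀ z → InDr Adj r D x z → InDr Adj r D y z) → toℕ x ⊑ toℕ y
      InDr⇒⊑ imp z fz near = Near-resp ≈-refl (toℕ-mod-≈ z) (InBall⇒Near (proj₂ (imp (z mod n)
        (true⇒∈ (trans (periodic-≈ per (toℕ-mod-≈ z)) fz) , Near⇒InBall (Near-resp ≈-refl (≈-sym (toℕ-mod-≈ z)) near)))))

      ⊑-resp : ∀ {x x′ y y′} → x ≈ x′ [mod n ] → y ≈ y′ [mod n ] → x ⊑ y → x′ ⊑ y′
      ⊑-resp x≈ y≈ x⊑y z fz near = Near-resp y≈ ≈-refl (x⊑y z fz (Near-resp (≈-sym x≈) ≈-refl near))

      identifying⇒separating : IsIdentifyingCode Adj r D → Separating
      identifying⇒separating (_ , sep) x y x⊑y y⊑x with (x % n) ≟ (y % n)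
      ... | yes x≡y = ≈-trans (≈-sym (%-≈ x)) (≈-trans (≡⇒≈ x≡y) (%-≈ y))
      ... | no x≢y = ⊥-elim (sep (x mod n) (y mod n)
        (λ eq → x≢y (trans (sym (toℕ-mod x)) (trans (cong toℕ eq) (toℕ-mod y))))
        (λ z → mk⇔ (⊑⇒InDr (⊑-resp (≈-sym (toℕ-mod-≈ x)) (≈-sym (toℕ-mod-≈ y)) x⊑y) z)
                   (⊑⇒InDr (⊑-resp (≈-sym (toℕ-mod-≈ y)) (≈-sym (toℕ-mod-≈ x)) y⊑x) z)))

      cover∧uniqueGap⇒identifying : q ≤ r → Cover q f → UniqueGap n q f → IsIdentifyingCode Adj r D
      cover∧uniqueGap⇒identifying q≤r cover unique = dominating , λ x y x≢y same → x≢y (toℕ-injective-≈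
          (cover∧uniqueGap⇒separating q≤r cover unique (toℕ x) (toℕ y)
            (InDr⇒⊑ (λ z → Equivalence.to (same z))) (InDr⇒⊑ (λ z → Equivalence.from (same z)))))
        where
        dominating : ∀ x → ∃ λ z → InDr Adj r D x z
        dominating x with ≡true? (f (toℕ x))
        ... | inj₁ fx = x , true⇒∈ fx , 0 , z≤n , here
        ... | inj₂ fx = (toℕ x + q) mod n , true⇒∈ (trans (periodic-≈ per (toℕ-mod-≈ (toℕ x + q))) (cover (toℕ x) fx)) ,
          q , q≤r , ascend q x _ (≈-sym (toℕ-mod-≈ (toℕ x + q)))

-- Parity, and inverses of the step up to sign

odd : ℕ → Bool
odd zero    = false
odd (suc n) = not (odd n)

odd-+ : ∀ m n → odd (m + n) ≡ odd m xor odd n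
odd-+ zero    n = refl
odd-+ (suc m) n rewrite odd-+ m n with odd m
... | true  = not-involutive (odd n)
... | false = refl

even-double : ∀ a → odd (a * 2) ≡ false
even-double zero    = refl
even-double (suc a) = trans (not-involutive _) (even-double a)

parity : ∀ l → (odd l ≡ false × ∃ λ a → l ≡ a * 2) ⊎ (odd l ≡ true × ∃ λ a → l ≡ suc (a * 2))
parity zero = inj₁ (refl , 0 , refl)
parity (suc l) with parity l
... | inj₁ (p , a , refl) = inj₂ (cong not p , a , refl)
... | inj₂ (p , a , refl) = inj₁ (cong not p , suc a , refl)

half-≤ : ∀ {h c} → suc (h * 2) ≤ c * 2 → h < c
half-≤ {h} {c} le = *-cancelʳ-< 2 h c le


-- The sign is left open because reversing a cycle preserves its covers. This absorbs the two forms
-- of Bézout's identity over the naturals and leaves the freedom to replace w by n - w, which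
-- changes its parity when n is odd.
Unit± : ℕ → ℕ → ℕ → Set
Unit± n q w = (w * q ≈ 1 [mod n ]) ⊎ (suc (w * q) ≈ 0 [mod n ])

square-of-−1 : ∀ {n a} → suc a ≈ 0 [mod n ] → a * a ≈ 1 [mod n ]
square-of-−1 {n} {a} e = +-cancelʳ-≈ a (≈-trans (≡⇒≈ ((a * a + a ≡ a * suc a) ∋ solve (a ∷ [])))
  (≈-trans (*-congˡ-≈ a e) (≈-trans (≡⇒≈ (*-zeroʳ a)) (≈-sym e))))

unit±-inverse : ∀ {n q w} → Unit± n q w → ∃ λ v → w * v ≈ 1 [mod n ]
unit±-inverse {n} {q} {w} (inj₁ e) = q , e
unit±-inverse {n} {q} {w} (inj₂ e) = q * (w * q) , ≈-trans (≡⇒≈ (sym (*-assoc w q (w * q)))) (square-of-−1 e)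

unit-cancel : ∀ {n v} w {a b} → w * v ≈ 1 [mod n ] → w * a ≈ w * b [mod n ] → a ≈ b [mod n ]
unit-cancel {n} {v} w {a} {b} wv≈1 e = ≈-trans (≈-sym (unfold a)) (≈-trans (*-congˡ-≈ v e) (unfold b))
  where
  unfold : ∀ a → v * (w * a) ≈ a [mod n ]
  unfold a = ≈-trans (≡⇒≈ ((v * (w * a) ≡ a * (w * v)) ∋ solve (v ∷ w ∷ a ∷ [])))
    (≈-trans (*-congˡ-≈ a wv≈1) (≡⇒≈ (*-identityʳ a)))

-- Lower bounds

-- Double counting: each edge (i, i + 1) contributes at least 1, and by periodicity the sum over all
-- edges counts every element of the cover twice.
cover-step₁ : ∀ n {e} → Periodic n e → Cover 1 e → n ≤ count n e * 2
cover-step₁ n {e} per cover = begin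
  n                                                   ≡⟨ trans (∑-const n 1) (*-identityʳ n) ⟨
  ∑ n (λ _ → 1)                                       ≤⟨ ∑-mono n (λ i _ → pair i (cover i)) ⟩
  ∑ n (λ i → ⟦ e i ⟧ + ⟦ e (i + 1) ⟧)                 ≡⟨ ∑-distrib-+ n _ _ ⟩
  count n e + ∑ n (λ i → ⟦ e (i + 1) ⟧)               ≡⟨ cong (count n e +_) (∑-shift (λ i → cong ⟦_⟧ (per i)) 1) ⟩
  count n e + count n e                               ≡⟨ cong (count n e +_) (+-identityʳ _) ⟨
  2 * count n e                                       ≡⟨ *-comm 2 (count n e) ⟩
  count n e * 2                                       ∎
  where
  open ≤-Reasoning
  pair : ∀ i → (e i ≡ false → e (i + 1) ≡ true) → 1 ≤ ⟦ e i ⟧ + ⟦ e (i + 1) ⟧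
  pair i c with e i | e (i + 1)
  ... | true  | _     = s≤s z≤n
  ... | false | true  = s≤s z≤n
  ... | false | false = contradiction (c refl) λ ()

cover-scale : ∀ {q f} → Cover q f → Cover 1 (λ i → f (q * i))
cover-scale {q} {f} cover p fp = trans (cong f ((q * (p + 1) ≡ q * p + q) ∋ solve (q ∷ p ∷ []))) (cover (q * p) fp)

count-scale : ∀ {n} .{{_ : NonZero n}} {f} → Periodic n f → ∀ w v → w * v ≈ 1 [mod n ] →
              count n (λ i → f (w * i)) ≡ count n f
count-scale {f = f} per w v = ∑-scale (λ i → cong ⟦_⟧ (per i)) w v

cover-coprime : ∀ {n q v} .{{_ : NonZero n}} {f} → Periodic n f → Cover q f → q * v ≈ 1 [mod n ] → n ≤ count n f * 2
cover-coprime {n} {q} {v} {f} per cover unit = subst (λ c → n ≤ c * 2) (count-scale per q v unit)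
  (cover-step₁ n (periodic-scale per q) (cover-scale {q} {f} cover))

count-classes : ∀ g n f → count (n * g) f ≡ ∑ g (λ c → count n (λ i → f (c + i * g)))
count-classes g n f = trans (∑-blocks g n _) (∑-swap n g (λ i c → ⟦ f (c + i * g) ⟧))

cover-classes : ∀ g h {q v f} → Periodic (suc (h * 2) * g) f → Cover (q * g) f →
                q * v ≈ 1 [mod suc (h * 2) ] → g * suc h ≤ count (suc (h * 2) * g) f
cover-classes g h {q} {v} {f} per cover unit = begin
  g * suc h                                       ≡⟨ ∑-const g (suc h) ⟨
  ∑ g (λ _ → suc h)                               ≤⟨ ∑-mono g (λ c _ → half-≤ {h} (cover-coprime {suc (h * 2)} {q} {v} (perᶜ c) (coverᶜ c) unit)) ⟩
  ∑ g (λ c → count (suc (h * 2)) (λ i → f (c + i * g)))    ≡⟨ count-classes g (suc (h * 2)) f ⟨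
  count (suc (h * 2) * g) f                       ∎
  where
  open ≤-Reasoning
  perᶜ : ∀ c → Periodic (suc (h * 2)) (λ i → f (c + i * g))
  perᶜ c i = trans (cong f ((c + (i + suc (h * 2)) * g ≡ c + i * g + suc (h * 2) * g)
      ∋ solve (c ∷ i ∷ h ∷ g ∷ []))) (per (c + i * g))
  coverᶜ : ∀ c → Cover q (λ i → f (c + i * g))
  coverᶜ c i fi = trans (cong f ((c + (i + q) * g ≡ c + i * g + q * g) ∋ solve (c ∷ i ∷ q ∷ g ∷ []))) (cover (c + i * g) fi)

not-xor : ∀ a b → not (a xor b) ≡ not a xor b
not-xor true  b = not-involutive b
not-xor false b = refl

repetition : ∀ (e : ℕ → Bool) m → (∃ λ i → e i ≡ e (suc i)) ⊎ (e m ≡ odd m xor e 0)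
repetition e zero    = inj₂ refl
repetition e (suc m) with repetition e m
... | inj₁ found = inj₁ found
... | inj₂ em with e m in eq | e (suc m) in eq′
...   | true  | true  = inj₁ (m , trans eq (sym eq′))
...   | false | false = inj₁ (m , trans eq (sym eq′))
...   | true  | false = inj₂ (trans (cong not em) (not-xor (odd m) (e 0)))
...   | false | true  = inj₂ (trans (cong not em) (not-xor (odd m) (e 0)))

-- A cover of an odd cycle of minimum size alternates, apart from a single adjacent pair.
minimum-cover-alternates : ∀ k {e} → Periodic (suc (k * 2)) e → Cover 1 e → count (suc (k * 2)) e ≤ suc k →
                           ∃ λ s → ∀ t → t < k → e (s + t * 2) ≡ false
minimum-cover-alternates k {e} per cover small with repetition e (suc (k * 2))
-- Strict alternation over an odd period would give position 2k + 1 the opposite value to position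
-- 0.
... | inj₂ flipped = ⊥-elim (bad (e 0) (trans (sym (per 0)) (trans flipped (cong (λ b → not b xor e 0) (even-double k)))))
  where
  bad : ∀ b → b ≡ not b → ⊥
  bad true  ()
  bad false ()
... | inj₁ (i , eᵢ≡eᵢ₊₁) = suc (suc i) , λ t t<k → trans (cong e ((suc (suc i) + t * 2 ≡ suc (t * 2) + suc i)
    ∋ solve (i ∷ t ∷ []))) (odd-false t t<k)
  where
  e′ : ℕ → Bool
  e′ j = e (j + suc i)
  both-true : e i ≡ true
  both-true with e i in eq
  ... | true  = refl
  ... | false = contradiction (trans (sym (cover i eq)) (trans (cong e (+-comm i 1)) (sym eᵢ≡eᵢ₊₁))) λ ()
  start : e′ 0 ≡ true
  start = trans (sym eᵢ≡eᵢ₊₁) both-true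
  end : e′ (k * 2) ≡ true
  end = trans (cong e ((k * 2 + suc i ≡ i + suc (k * 2)) ∋ solve (k ∷ i ∷ []))) (trans (per i) both-true)
  pair : ℕ → ℕ
  pair t = ⟦ e′ (t * 2) ⟧ + ⟦ e′ (suc (t * 2)) ⟧
  next : ∀ j → e′ j ≡ false → e′ (suc j) ≡ true
  next j ej = trans (cong e (+-comm 1 (j + suc i))) (cover (j + suc i) ej)
  1≤pair : ∀ t → 1 ≤ pair t
  1≤pair t with e′ (t * 2) in eq
  ... | true  = s≤s z≤n
  ... | false rewrite next (t * 2) eq = s≤s z≤n
  -- Positions are counted from the second of the two adjacent elements, so the first one sits at
  -- position 2k and is left over by the k pairs. Removing it from at most k + 1 elements leaves at
  -- most k, hence exactly one per pair, and the cover property propagates the pattern from position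
  -- 0.
  total : ∑ k pair ≤ ∑ k (λ _ → 1)
  total = s≤s⁻¹ (begin
    suc (∑ k pair)                                    ≡⟨ +-comm 1 _ ⟩
    ∑ k pair + 1                                      ≡⟨ cong₂ _+_ (∑-pairs k (λ j → ⟦ e′ j ⟧)) (cong ⟦_⟧ end) ⟨
    ∑ (k * 2) (λ j → ⟦ e′ j ⟧) + ⟦ e′ (k * 2) ⟧       ≡⟨ ∑-last (k * 2) (λ j → ⟦ e′ j ⟧) ⟨
    ∑ (suc (k * 2)) (λ j → ⟦ e′ j ⟧)                  ≡⟨ ∑-shift (λ j → cong ⟦_⟧ (per j)) (suc i) ⟩
    count (suc (k * 2)) e                             ≤⟨ small ⟩
    suc k                                             ≡⟨ cong suc (trans (∑-const k 1) (*-identityʳ k)) ⟨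
    suc (∑ k (λ _ → 1))                               ∎)
    where open ≤-Reasoning
  pair≡1 : ∀ t → t < k → 1 ≡ pair t
  pair≡1 = ∑-≤-pointwise k (λ t _ → 1≤pair t) total
  even-true : ∀ t → t < k → e′ (t * 2) ≡ true
  odd-false : ∀ t → t < k → e′ (suc (t * 2)) ≡ false
  even-true zero    _   = start
  even-true (suc t) t<k = next (suc (t * 2)) (odd-false t (<-trans (n<1+n t) t<k))
  odd-false t t<k with e′ (suc (t * 2)) | even-true t t<k | pair≡1 t t<k
  ... | false | _  | _ = refl
  ... | true  | et | p rewrite et = contradiction p λ ()

multiple-bound : ∀ {o t a q x} → o + suc t ≡ q → x ≤ a → x + o * a ≤ a * q
multiple-bound {o} {t} {a} {_} {x} refl x≤a = ≤-certificate (t * a) x≤a (solve (o ∷ t ∷ a ∷ x ∷ []))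

-- Lower bound k + 2 in the exceptional cases

module _ {k q : ℕ} {f : ℕ → Bool} (per : Periodic (suc (k * 2)) f) (cover : Cover q f)
         (0<2q : 0 < 2 * q) (2q<n : 2 * q < suc (k * 2)) (unique : UniqueGap (suc (k * 2)) q f) where

  private
    n = suc (k * 2)

    resp-≈ : ∀ {a b} → a ≈ b [mod n ] → f a ≡ f b
    resp-≈ = periodic-≈ {f = f} per

    two-gaps : ∀ A → Gap q f A → Gap q f (2 * q + A) → ⊥
    two-gaps A gap gap′ = <⇒≢ 0<2q
      (≈⇒≡ {n} (<-trans 0<2q 2q<n) 2q<n (+-cancelʳ-≈ A (unique A (2 * q + A) gap gap′)))

  -- With at most k + 1 elements, the indices i whose vertex q i is missing would include a
  -- progression of k terms with step 2. The callers refute this by finding two gaps in it.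
  not-minimum : ∀ v → q * v ≈ 1 [mod n ] →
                ((s : ℕ) → (∀ t → t < k → f (q * (s + t * 2)) ≡ false) → ⊥) → k + 2 ≤ count n f
  not-minimum v unit impossible with ≤-<-connex (count n f) (suc k)
  ... | inj₂ 1+k< = ≤-trans (≤-reflexive (+-comm k 2)) 1+k<
  ... | inj₁ small = ⊥-elim (impossible (proj₁ alternation) (proj₂ alternation))
    where
    e : ℕ → Bool
    e i = f (q * i)
    alternation : ∃ λ s → ∀ t → t < k → e (s + t * 2) ≡ false
    alternation = minimum-cover-alternates k {e} (periodic-scale {f = f} per q) (cover-scale {q} {f} cover)
      (subst (_≤ suc k) (sym (count-scale {n} {f} per q v unit)) small)

  -- Here n = 2aq + 1, so raising an index by 2a moves its vertex by -1. The missing indices thus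
  -- contain a gap read backwards, vertex t having index s + 2a(q - 1 - t). Raising all its indices
  -- by 2 moves the gap by 2q. This second gap fits because (q - 1)a + 1 < aq = k, which is where a
  -- ≥ 2 enters.
  exceptional⁻ : ∀ a → 2 ≤ a → k ≡ a * q → k + 2 ≤ count n f
  exceptional⁻ a 2≤a k≡ = not-minimum (proj₁ inverse) (proj₂ inverse) λ s alt → two-gaps (start s) (gap s alt) (gap′ s alt)
    where
    minus-one : suc (q * (a * 2)) ≈ 0 [mod n ]
    minus-one = shift 0 1 (≡-certificate (cong (_* 2) (sym k≡))
      ((k * 2 + (suc (q * (a * 2)) + 0 * suc (k * 2)) ≡ a * q * 2 + (0 + 1 * suc (k * 2))) ∋ solve (a ∷ q ∷ k ∷ [])))
    inverse : ∃ λ v → q * v ≈ 1 [mod n ]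
    inverse = unit±-inverse {n} {a * 2} {q} (inj₂ minus-one)
    start : ℕ → ℕ
    start s = q * (s + (q ∸ 1) * a * 2)
    index : ∀ s t o → suc t + o ≡ q → start s + t ≈ q * (s + o * a * 2) [mod n ]
    index s t o t+o≡q = shift 0 t (trans (cong (λ p → q * (s + p * a * 2) + t + 0 * n) (cong (_∸ 1) (sym t+o≡q)))
      (≡-certificate (cong (_* (t * 2)) (sym k≡))
        ((k * (t * 2) + (q * (s + (t + o) * a * 2) + t + 0 * suc (k * 2)) ≡ a * q * (t * 2) + (q * (s + o * a * 2) + t * suc (k * 2)))
            ∋ solve (q ∷ s ∷ a ∷ t ∷ o ∷ k ∷ []))))
    bound : ∀ t o → suc t + o ≡ q → 2 + o * a ≤ k
    bound t o t+o≡q = ≤-trans (multiple-bound (trans (+-comm o (suc t)) t+o≡q) 2≤a) (≤-reflexive (sym k≡))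
    gap : ∀ s → (∀ t → t < k → f (q * (s + t * 2)) ≡ false) → Gap q f (start s)
    gap s alt t t<q with o , t+o≡q ← m≤n⇒∃[o]m+o≡n t<q =
      trans (resp-≈ (index s t o t+o≡q)) (alt (o * a) (<-trans (n<1+n _) (bound t o t+o≡q)))
    gap′ : ∀ s → (∀ t → t < k → f (q * (s + t * 2)) ≡ false) → Gap q f (2 * q + start s)
    gap′ s alt t t<q with o , t+o≡q ← m≤n⇒∃[o]m+o≡n t<q =
      trans (resp-≈ {2 * q + start s + t} {q * (s + suc (o * a) * 2)} (≈-trans {b = start s + t + 2 * q} (≡⇒≈ (swap (start s)))
        (≈-trans {b = q * (s + o * a * 2) + 2 * q} (+-congʳ-≈ (2 * q) (index s t o t+o≡q))
        (≡⇒≈ ((q * (s + o * a * 2) + 2 * q ≡ q * (s + suc (o * a) * 2)) ∋ solve (q ∷ s ∷ o ∷ a ∷ []))))))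
      (alt (suc (o * a)) (bound t o t+o≡q))
      where
      swap : ∀ x → 2 * q + x + t ≡ x + t + 2 * q
      swap x = solve (q ∷ x ∷ t ∷ [])

  -- Here n = 2aq - 1, so 2a is the inverse of q and the gap is read forwards along the indices s +
  -- 2at. The translate by 2 must satisfy (q - 1)a + 1 < k with k = aq - 1 now smaller by one, hence
  -- a ≥ 3.
  exceptional⁺ : ∀ a → 3 ≤ a → suc k ≡ a * q → k + 2 ≤ count n f
  exceptional⁺ a 3≤a 1+k≡ = not-minimum (proj₁ inverse) (proj₂ inverse) λ s alt → two-gaps (q * s) (gap s alt) (gap′ s alt)
    where
    one : q * (a * 2) ≈ 1 [mod n ]
    one = shift 0 1 (≡-certificate (cong (_* 2) (sym 1+k≡))
      ((suc k * 2 + (q * (a * 2) + 0 * suc (k * 2)) ≡ a * q * 2 + (1 + 1 * suc (k * 2))) ∋ solve (a ∷ q ∷ k ∷ [])))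
    inverse : ∃ λ v → q * v ≈ 1 [mod n ]
    inverse = unit±-inverse {n} {a * 2} {q} (inj₁ one)
    index : ∀ s t → q * s + t ≈ q * (s + t * a * 2) [mod n ]
    index s t = shift t 0 (≡-certificate (cong (_* (t * 2)) 1+k≡)
      ((a * q * (t * 2) + (q * s + t + t * suc (k * 2)) ≡ suc k * (t * 2) + (q * (s + t * a * 2) + 0 * suc (k * 2)))
          ∋ solve (q ∷ s ∷ a ∷ t ∷ k ∷ [])))
    bound : ∀ t → t < q → 2 + t * a ≤ k
    bound t t<q with o , t+o≡q ← m≤n⇒∃[o]m+o≡n t<q = s≤s⁻¹ (≤-trans
      (multiple-bound (trans (+-suc t o) t+o≡q) 3≤a) (≤-reflexive (sym 1+k≡)))
    gap : ∀ s → (∀ t → t < k → f (q * (s + t * 2)) ≡ false) → Gap q f (q * s)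
    gap s alt t t<q = trans (resp-≈ (index s t)) (alt (t * a) (<-trans (n<1+n _) (bound t t<q)))
    gap′ : ∀ s → (∀ t → t < k → f (q * (s + t * 2)) ≡ false) → Gap q f (2 * q + q * s)
    gap′ s alt t t<q = trans (resp-≈ {2 * q + q * s + t} {q * (s + suc (t * a) * 2)}
      (≈-trans {b = q * (s + 2) + t} (≡⇒≈ ((2 * q + q * s + t ≡ q * (s + 2) + t) ∋ solve (q ∷ s ∷ t ∷ [])))
      (≈-trans {b = q * (s + 2 + t * a * 2)} (index (s + 2) t)
        (≡⇒≈ ((q * (s + 2 + t * a * 2) ≡ q * (s + suc (t * a) * 2)) ∋ solve (q ∷ s ∷ t ∷ a ∷ []))))))
      (alt (suc (t * a)) (bound t t<q))

-- Constructions

-- As n is odd, one of y and n - y is even for the residue y of x, and exchanging them only changes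
-- the sign of the unit.
even-unit : ∀ {h q x} → Unit± (suc (h * 2)) q x →
            ∃ λ w → w < suc (h * 2) × odd w ≡ false × Unit± (suc (h * 2)) q w
even-unit {h} {q} {x} unit with ≡true? (odd (x % suc (h * 2)))
... | inj₂ even = x % n , m%n<n x n , even , reduce unit
  where
  n = suc (h * 2)
  ≈x : x % n * q ≈ x * q [mod n ]
  ≈x = ≈-trans (≡⇒≈ (*-comm (x % n) q)) (≈-trans (*-congˡ-≈ q (%-≈ x)) (≡⇒≈ (*-comm q x)))
  reduce : Unit± n q x → Unit± n q (x % n)
  reduce (inj₁ e) = inj₁ (≈-trans ≈x e)
  reduce (inj₂ e) = inj₂ (≈-trans (suc-cong-≈ ≈x) e)
... | inj₁ isOdd = o , o<n , even , negate unit
  where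
  n = suc (h * 2)
  y = x % n
  o : ℕ
  o = proj₁ (m≤n⇒∃[o]m+o≡n (<⇒≤ (m%n<n x n)))
  y+o≡n : y + o ≡ n
  y+o≡n = proj₂ (m≤n⇒∃[o]m+o≡n (<⇒≤ (m%n<n x n)))
  smaller : ∀ y {o} → odd y ≡ true → y + o ≡ n → o < n
  smaller (suc y) {o} _ eq = ≤-trans (s≤s (m≤n+m o y)) (≤-reflexive eq)
  o<n : o < n
  o<n = smaller y isOdd y+o≡n
  even : odd o ≡ false
  even = not-injective (trans (cong (_xor odd o) (sym isOdd)) (trans (sym (odd-+ y o)) (trans (cong odd y+o≡n) (cong not (even-double h)))))
  ≈x : y * q ≈ x * q [mod n ]
  ≈x = ≈-trans (≡⇒≈ (*-comm y q)) (≈-trans (*-congˡ-≈ q (%-≈ x)) (≡⇒≈ (*-comm q x)))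
  sum≈0 : o * q + x * q ≈ 0 [mod n ]
  sum≈0 = ≈-trans (≈-trans (≡⇒≈ (+-comm (o * q) (x * q))) (+-congʳ-≈ (o * q) (≈-sym ≈x)))
    (shift 0 q (trans (distrib y o) (trans (cong (_* q) y+o≡n) (*-comm n q))))
    where
    distrib : ∀ y o → y * q + o * q + 0 * n ≡ (y + o) * q
    distrib y o = trans (+-identityʳ _) (sym (*-distribʳ-+ q y o))
  negate : Unit± n q x → Unit± n q o
  negate (inj₁ e) = inj₂ (≈-trans (≡⇒≈ (+-comm 1 (o * q))) (≈-trans (add e) sum≈0))
    where
    add : x * q ≈ 1 [mod n ] → o * q + 1 ≈ o * q + x * q [mod n ]
    add e = ≈-trans (≡⇒≈ (+-comm (o * q) 1)) (≈-trans (+-congʳ-≈ (o * q) (≈-sym e)) (≡⇒≈ (+-comm (x * q) (o * q))))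
  negate (inj₂ e) = inj₁ (+-cancelʳ-≈ (x * q) (≈-trans sum≈0 (≈-sym e)))

-- Adding q to p moves `w * p + s` by ±1. For -1 the edge is traversed backwards, so the cover
-- property is applied at its other end.
cover-unit : ∀ {n q w} {e : ℕ → Bool} → Periodic n e → Unit± n q w → Cover 1 e → ∀ s → Cover q (λ p → e (w * p + s))
cover-unit {n} {q} {w} {e} per (inj₁ one) cover s p ep =
  trans (periodic-≈ {f = e} per {w * (p + q) + s} {w * p + s + 1}
      (≈-trans (≡⇒≈ ((w * (p + q) + s ≡ w * q + (w * p + s)) ∋ solve (w ∷ p ∷ q ∷ s ∷ [])))
        (≈-trans (+-congʳ-≈ (w * p + s) one) (≡⇒≈ (+-comm 1 (w * p + s))))))
    (cover (w * p + s) ep)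
cover-unit {n} {q} {w} {e} per (inj₂ minus-one) cover s p ep with ≡true? (e (w * (p + q) + s))
... | inj₁ t = t
... | inj₂ e-next = contradiction (trans (sym (cover (w * (p + q) + s) e-next)) (trans
      (periodic-≈ {f = e} per {w * (p + q) + s + 1} {w * p + s}
        (≈-trans (≡⇒≈ ((w * (p + q) + s + 1 ≡ suc (w * q) + (w * p + s)) ∋ solve (w ∷ p ∷ q ∷ s ∷ [])))
          (+-congʳ-≈ (w * p + s) minus-one))) ep)) λ ()

count-unit : ∀ {n q w} .{{_ : NonZero n}} {e : ℕ → Bool} → Periodic n e → Unit± n q w →
             ∀ s → count n (λ p → e (w * p + s)) ≡ count n e
count-unit {n} {q} {w} {e} per unit s with v , wv≈1 ← unit±-inverse {n} {q} {w} unit = trans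
  (count-scale {n} {λ i → e (i + s)} (periodic-shift {f = e} per s) w v wv≈1)
  (∑-shift {n} {λ i → ⟦ e i ⟧} (λ i → cong ⟦_⟧ (per i)) s)

extend : ℕ → (ℕ → Bool) → ℕ → Bool
extend N e i = e (i % suc N)

module _ {N : ℕ} {e : ℕ → Bool} where

  extend-periodic : Periodic (suc N) (extend N e)
  extend-periodic = periodic-% {n = suc N} e

  extend-≡ : ∀ {i} → i < suc N → extend N e i ≡ e i
  extend-≡ i<n = cong e (m<n⇒m%n≡m i<n)

  extend-cover : (∀ i → i < N → e i ≡ false → e (suc i) ≡ true) → e N ≡ true → Cover 1 (extend N e)
  extend-cover next-true last p ep with m≤n⇒m<n∨m≡n (s≤s⁻¹ (m%n<n p (suc N)))
  ... | inj₁ x<N = trans (cong e next) (next-true (p % suc N) x<N ep)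
    where
    next : (p + 1) % suc N ≡ suc (p % suc N)
    next = trans (≈⇒%≡ {suc N} {p + 1} {suc (p % suc N)} (≈-trans (+-congʳ-≈ 1 (≈-sym (%-≈ p))) (≡⇒≈ (+-comm (p % suc N) 1))))
      (m<n⇒m%n≡m (s≤s x<N))
  ... | inj₂ x≡N = contradiction (trans (sym last) (trans (cong e (sym x≡N)) ep)) λ ()

  extend-count : count (suc N) (extend N e) ≡ count (suc N) e
  extend-count = ∑-cong (suc N) (λ i i<n → cong ⟦_⟧ (extend-≡ i<n))

-- For even N, a minimum vertex cover of the cycle 0, …, N.
base : ℕ → ℕ → Bool
base N i = odd i ∨ does (i ≟ N)

base-odd : ∀ {N i} → odd i ≡ true → base N i ≡ true
base-odd {N} {i} isOdd = cong (_∨ does (i ≟ N)) isOdd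

base-last : ∀ N → base N N ≡ true
base-last N = trans (cong (odd N ∨_) (dec-true (N ≟ N) refl)) (∨-zeroʳ (odd N))

base-even : ∀ {N i} → odd i ≡ false → i ≢ N → base N i ≡ false
base-even {N} {i} even i≢N = cong₂ _∨_ even (dec-false (i ≟ N) i≢N)

base-false : ∀ {N i} → base N i ≡ false → odd i ≡ false × i ≢ N
base-false {N} {i} eq with ≡true? (odd i)
... | inj₁ isOdd = contradiction (trans (sym (base-odd {N} {i} isOdd)) eq) λ ()
... | inj₂ even = even , λ i≡N → contradiction (trans (sym (base-last N)) (trans (cong (base N) (sym i≡N)) eq)) λ ()

base-cover : ∀ N → Cover 1 (extend N (base N))
base-cover N = extend-cover {N} {base N} (λ i _ eq → base-odd {N} {suc i} (cong not (proj₁ (base-false {N} {i} eq)))) (base-last N)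

pair : (ℕ → Bool) → ℕ → ℕ
pair e i = ⟦ e (i * 2) ⟧ + ⟦ e (suc (i * 2)) ⟧

base-pair : ∀ {h i} → i < h → pair (base (h * 2)) i ≡ 1
base-pair {h} {i} i<h = cong₂ (λ b b′ → ⟦ b ⟧ + ⟦ b′ ⟧)
  (base-even {h * 2} {i * 2} (even-double i) (λ eq → <⇒≢ i<h (*-cancelʳ-≡ i h 2 eq)))
  (base-odd {h * 2} {suc (i * 2)} (cong not (even-double i)))

base-count : ∀ h → count (suc (h * 2)) (extend (h * 2) (base (h * 2))) ≡ suc h
base-count h = begin
  count (suc (h * 2)) (extend (h * 2) (base (h * 2)))      ≡⟨ extend-count {h * 2} {base (h * 2)} ⟩
  count (suc (h * 2)) (base (h * 2))                       ≡⟨ ∑-last (h * 2) _ ⟩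
  count (h * 2) (base (h * 2)) + ⟦ base (h * 2) (h * 2) ⟧  ≡⟨ cong₂ _+_ pairs (cong ⟦_⟧ (base-last (h * 2))) ⟩
  h + 1                                                    ≡⟨ +-comm h 1 ⟩
  suc h                                                    ∎
  where
  open ≡-Reasoning
  pairs : count (h * 2) (base (h * 2)) ≡ h
  pairs = trans (∑-pairs h _) (trans (∑-cong h (λ i i<h → base-pair {h} {i} i<h)) (trans (∑-const h 1) (*-identityʳ h)))

-- For gcd g > 1 the code is placed on the residue classes mod g, shifted by one step on all classes but that of 0.
module Classes (g h q′ w : ℕ) .{{_ : NonZero g}} (2≤g : 2 ≤ g) (2≤q′ : 2 ≤ q′) (unit : Unit± (suc (h * 2)) q′ w) where

  private
    n′ = suc (h * 2)
    E : ℕ → Bool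
    E = extend (h * 2) (base (h * 2))
    E-periodic : Periodic n′ E
    E-periodic = extend-periodic {h * 2} {base (h * 2)}

  nonzero : ℕ → ℕ
  nonzero zero    = 0
  nonzero (suc _) = 1

  code : ℕ → Bool
  code p = E (w * (p / g) + nonzero (p % g))

  code-shift : ∀ p x → code (p + x * g) ≡ E (w * (p / g + x) + nonzero (p % g))
  code-shift p x = cong₂ (λ a c → E (w * a + nonzero c))
    (trans (+-distrib-/-∣ʳ p (divides x refl)) (cong (p / g +_) (m*n/n≡m x g)))
    ([m+kn]%n≡m%n p x g)

  code-class : ∀ {c} i → c < g → code (c + i * g) ≡ E (w * i + nonzero c)
  code-class {c} i c<g = trans (code-shift c i) (cong₂ (λ a b → E (w * (a + i) + nonzero b)) (m<n⇒m/n≡0 c<g) (m<n⇒m%n≡m c<g))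

  code-periodic : Periodic (n′ * g) code
  code-periodic p = trans (code-shift p n′) (trans
    (cong E ((w * (p / g + n′) + nonzero (p % g) ≡ w * (p / g) + nonzero (p % g) + w * n′) ∋ regroup (p / g) (nonzero (p % g)) n′))
    (periodic-+* {f = E} E-periodic (w * (p / g) + nonzero (p % g)) w))
    where
    regroup : ∀ a b c → w * (a + c) + b ≡ w * a + b + w * c
    regroup a b c = solve (w ∷ a ∷ b ∷ c ∷ [])

  code-cover : Cover (q′ * g) code
  code-cover p eq = trans (code-shift p q′)
    (cover-unit {n′} {q′} {w} {e = E} E-periodic unit (base-cover (h * 2)) (nonzero (p % g)) (p / g) eq)

  -- A run of q′ g ≥ 2g vertices contains some multiple i g together with i g + 1. These are in the
  -- classes 0 and 1, so the shift makes their values those of the adjacent positions w i and w i +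
  -- 1 of the base cover, which are not both missing.
  code-no-gap : ∀ a → ¬ Gap (q′ * g) code a
  code-no-gap a gap = contradiction (trans (sym (base-cover (h * 2) (w * i + 0) first)) second) λ ()
    where
    i : ℕ
    i = suc (a / g)
    o : ℕ
    o = proj₁ (m≤n⇒∃[o]m+o≡n (<⇒≤ (m%n<n a g)))
    r+o≡g : a % g + o ≡ g
    r+o≡g = proj₂ (m≤n⇒∃[o]m+o≡n (<⇒≤ (m%n<n a g)))
    a+o≡ : a + o ≡ i * g
    a+o≡ = trans (cong (_+ o) (m≡m%n+[m/n]*n a g)) (trans (regroup (a % g) (a / g * g) o) (cong (_+ a / g * g) r+o≡g))
      where
      regroup : ∀ x y z → x + y + z ≡ x + z + y
      regroup x y z = solve (x ∷ y ∷ z ∷ [])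
    o≤g : o ≤ g
    o≤g = ≤-trans (m≤n+m o (a % g)) (≤-reflexive r+o≡g)
    g*2≤q : 2 * g ≤ q′ * g
    g*2≤q = *-mono-≤ 2≤q′ (≤-refl {g})
    1+o<q : suc o < q′ * g
    1+o<q = ≤-trans (+-mono-≤ 2≤g o≤g) (≤-trans (≤-reflexive (cong (g +_) (sym (+-identityʳ g)))) g*2≤q)
    first : E (w * i + 0) ≡ false
    first = trans (sym (code-class {0} i (<-trans z<s 2≤g))) (trans (cong code (sym a+o≡)) (gap o (<-trans (n<1+n o) 1+o<q)))
    second : E (w * i + 0 + 1) ≡ false
    second = trans (cong E (+-assoc (w * i) 0 1)) (trans (sym (code-class {1} i 2≤g))
      (trans (cong code (trans (cong suc (sym a+o≡)) (sym (+-suc a o)))) (gap (suc o) 1+o<q)))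

  code-count : count (n′ * g) code ≡ g * suc h
  code-count = trans (count-classes g n′ code) (trans (∑-cong g (λ c c<g → begin
      count n′ (λ i → code (c + i * g))        ≡⟨ ∑-cong n′ (λ i _ → cong ⟦_⟧ (code-class i c<g)) ⟩
      count n′ (λ i → E (w * i + nonzero c))   ≡⟨ count-unit {n′} {q′} {w} {e = E} E-periodic unit (nonzero c) ⟩
      count n′ E                               ≡⟨ base-count h ⟩
      suc h                                    ∎)) (∑-const g (suc h)))
    where open ≡-Reasoning

-- For gcd 1 the code is an arithmetic progression of step w⁻¹. As w is even and n odd, a gap cannot wrap around
-- modulo n in the coordinate w p, so it is given by an even start i with i + (q − 1) w < n − 1.
module Single (h q w : ℕ) (even-w : odd w ≡ false) (w<n : w < suc (h * 2)) (unit : Unit± (suc (h * 2)) q w) where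

  private
    N = h * 2
    n = suc N
    E : ℕ → Bool
    E = extend N (base N)
    E-periodic : Periodic n E
    E-periodic = extend-periodic {N} {base N}

  code : ℕ → Bool
  code p = E (w * p + 0)

  code-periodic : Periodic n code
  code-periodic = periodic-scale {f = λ i → E (i + 0)} (periodic-shift {f = E} E-periodic 0) w

  code-cover : Cover q code
  code-cover = cover-unit {n} {q} {w} {E} E-periodic unit (base-cover N) 0

  code-count : count n code ≡ suc h
  code-count = trans (count-unit {n} {q} {w} {e = E} E-periodic unit 0) (base-count h)

  private
    false⇒ : ∀ {x} → x < n → E x ≡ false → odd x ≡ false × x < N
    false⇒ {x} x<n eq with even , x≢N ← base-false {N} {x} (trans (sym (extend-≡ {N} {base N} x<n)) eq) =
      even , ≤∧≢⇒< (s≤s⁻¹ x<n) x≢N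

    advance : ∀ x → odd x ≡ false → x < N → E (x + w) ≡ false → odd (x + w) ≡ false × x + w < N
    advance x even x<N eq with <-≤-connex (x + w) n
    ... | inj₁ x+w<n = false⇒ x+w<n eq
    ... | inj₂ n≤x+w with o , n+o≡ ← m≤n⇒∃[o]m+o≡n n≤x+w = contradiction
          (trans (sym (trans (odd-+ n o) (cong₂ _xor_ (cong not (even-double h)) even-o)))
            (trans (cong odd n+o≡) (trans (odd-+ x w) (cong₂ _xor_ even even-w)))) λ ()
      where
      o<n : o < n
      o<n = +-cancelˡ-< n o n (≤-trans (s≤s (≤-reflexive n+o≡)) (+-mono-≤ (s≤s (<⇒≤ x<N)) (<⇒≤ w<n)))
      even-o : odd o ≡ false
      even-o = proj₁ (false⇒ o<n (trans (sym (E-periodic o)) (trans (cong E (trans (+-comm o n) n+o≡)) eq)))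

    start : ℕ → ℕ
    start a = (w * a) % n

    track : ∀ a → Gap q code a → ∀ t → t < q → odd (start a + t * w) ≡ false × start a + t * w < N
    track a gap t t<q = go t t<q
      where
      value : ∀ t → t < q → E (start a + t * w) ≡ false
      value t t<q = trans (periodic-≈ {f = E} E-periodic {start a + t * w} {w * (a + t) + 0}
        (≈-trans (+-congʳ-≈ (t * w) (%-≈ {n} (w * a))) (≡⇒≈ ((w * a + t * w ≡ w * (a + t) + 0)
            ∋ solve (w ∷ a ∷ t ∷ []))))) (gap t t<q)
      go : ∀ t → t < q → odd (start a + t * w) ≡ false × start a + t * w < N
      go zero    t<q = false⇒ (≤-trans (s≤s (≤-reflexive (+-identityʳ (start a)))) (m%n<n (w * a) n)) (value 0 t<q)
      go (suc t) t<q with even , lt ← go t (<-trans (n<1+n t) t<q) =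
        subst (λ x → odd x ≡ false × x < N) (regroup (start a))
          (advance (start a + t * w) even lt (trans (cong E (regroup (start a))) (value (suc t) t<q)))
        where
        regroup : ∀ x → x + t * w + w ≡ x + suc t * w
        regroup x = solve (x ∷ t ∷ w ∷ [])

  -- A start other than 0 is even, hence at least 2, and the last term of the progression would then
  -- violate the assumed bound. So every gap starts at position 0, and multiplication by w is
  -- injective modulo n.
  code-uniqueGap : ∀ p → q ≡ suc p → ¬ (2 + p * w < N) → UniqueGap n q code
  code-uniqueGap p refl short a b gapA gapB = unit-cancel {n} {proj₁ inverse} w {a} {b} (proj₂ inverse)
    (≈-trans (≈-sym (%-≈ {n} (w * a))) (≈-trans (≡⇒≈ (trans (at-zero a gapA) (sym (at-zero b gapB)))) (%-≈ {n} (w * b))))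
    where
    inverse : ∃ λ v → w * v ≈ 1 [mod n ]
    inverse = unit±-inverse {n} {q} {w} unit
    zero-or-≥2 : ∀ i → odd (i + 0) ≡ false → i + p * w < N → i ≡ 0
    zero-or-≥2 zero          _  _  = refl
    zero-or-≥2 (suc zero)    () _
    zero-or-≥2 (suc (suc i)) _  lt = contradiction (≤-trans (s≤s (+-monoˡ-≤ (p * w) (s≤s (s≤s z≤n)))) lt) short
    at-zero : ∀ a → Gap q code a → start a ≡ 0
    at-zero a gap = zero-or-≥2 (start a) (proj₁ (track a gap 0 z<s)) (proj₂ (track a gap p ≤-refl))

-- The exceptional case n = L q ± 1 with L even: three pairs of adjacent code elements (in the coordinate L p),
-- at least L − 1 apart. A gap has step L there, so it would have to fit in one of the three arcs.
module Exceptional (a h q : ℕ) (2≤q : 2 ≤ q) (3L≤n : 3 * (suc a * 2) ≤ suc (h * 2))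
                   (n≤ : suc (h * 2) ≤ suc (suc a * 2 * q)) (unit : Unit± (suc (h * 2)) q (suc a * 2)) where

  private
    N = h * 2
    n = suc N
    c = suc a + a
    L = suc a * 2
    M = suc (c * 2)

  -- With M = 2L - 1 = 2c + 1, the adjacent pairs are (L - 1, L) and (M - 1, M), where the chosen
  -- parity changes, and (N - 1, N) at the end.
  pattern′ : ℕ → Bool
  pattern′ i = if does (i <? L) then base N i else (if does (i <? M) then not (odd i) else base N i)

  private
    E : ℕ → Bool
    E = extend N pattern′
    E-periodic : Periodic n E
    E-periodic = extend-periodic {N} {pattern′}

    suc-M : suc M ≡ L + L
    suc-M = (suc (suc ((suc a + a) * 2)) ≡ suc a * 2 + suc a * 2) ∋ solve (a ∷ [])

    L<M : L < M
    L<M = s≤s (*-mono-≤ (m≤m+n (suc a) a) (≤-refl {2}))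

    odd-M : odd M ≡ true
    odd-M = cong not (even-double c)

    M+L<n : M + L < n
    M+L<n = ≤-trans (≤-reflexive ((suc (suc ((suc a + a) * 2) + suc a * 2) ≡ 3 * (suc a * 2)) ∋ solve (a ∷ []))) 3L≤n

    M≤N : M ≤ N
    M≤N = ≤-trans (m≤m+n M L) (s≤s⁻¹ M+L<n)

    low : ∀ {i} → i < L → pattern′ i ≡ base N i
    low {i} i<L = cong (λ b → if b then base N i else (if does (i <? M) then not (odd i) else base N i)) (dec-true (i <? L) i<L)

    mid : ∀ {i} → L ≤ i → i < M → pattern′ i ≡ not (odd i)
    mid {i} L≤i i<M = cong₂ (λ b b′ → if b then base N i else (if b′ then not (odd i) else base N i))
      (dec-false (i <? L) (≤⇒≯ L≤i)) (dec-true (i <? M) i<M)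

    high : ∀ {i} → M ≤ i → pattern′ i ≡ base N i
    high {i} M≤i = cong₂ (λ b b′ → if b then base N i else (if b′ then not (odd i) else base N i))
      (dec-false (i <? L) (≤⇒≯ (≤-trans (<⇒≤ L<M) M≤i))) (dec-false (i <? M) (≤⇒≯ M≤i))

    data Arc (i : ℕ) : Set where
      arc-low  : i < L → Arc i
      arc-mid  : L ≤ i → i < M → Arc i
      arc-high : M ≤ i → Arc i

    arc : ∀ i → Arc i
    arc i with <-≤-connex i L | <-≤-connex i M
    ... | inj₁ i<L | _        = arc-low i<L
    ... | inj₂ L≤i | inj₁ i<M = arc-mid L≤i i<M
    ... | inj₂ _   | inj₂ M≤i = arc-high M≤i

    pattern-cover : Cover 1 E
    pattern-cover = extend-cover {N} {pattern′} next-true (trans (high M≤N) (base-last N))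
      where
      next-true : ∀ i → i < N → pattern′ i ≡ false → pattern′ (suc i) ≡ true
      next-true i _ eq with arc i
      ... | arc-low i<L with odd-1+i ← cong not (proj₁ (base-false {N} {i} (trans (sym (low i<L)) eq))) | m≤n⇒m<n∨m≡n i<L
      ...   | inj₁ 1+i<L = trans (low 1+i<L) (base-odd {N} {suc i} odd-1+i)
      ...   | inj₂ 1+i≡L = trans (cong pattern′ 1+i≡L) (trans (mid ≤-refl L<M) (cong not (even-double (suc a))))
      next-true i _ eq | arc-mid L≤i i<M with m≤n⇒m<n∨m≡n i<M
      ...   | inj₁ 1+i<M = trans (mid (≤-trans L≤i (n≤1+n i)) 1+i<M) (cong not (trans (sym (mid L≤i i<M)) eq))
      ...   | inj₂ 1+i≡M = trans (cong pattern′ 1+i≡M) (trans (high ≤-refl) (base-odd {N} {M} odd-M))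
      next-true i _ eq | arc-high M≤i = trans (high (≤-trans M≤i (n≤1+n i)))
        (base-odd {N} {suc i} (cong not (proj₁ (base-false {N} {i} (trans (sym (high M≤i)) eq)))))

    -- A jump by the even number L keeps the parity. From the first arc it lands in the second, and
    -- from the second in the third, where the missing parity is the opposite one. Wrapping around
    -- lands in the first arc with the parity changed by the odd n. Only a jump inside the third arc
    -- can join two missing positions.
    advance : ∀ x → x < n → pattern′ x ≡ false → E (x + L) ≡ false → M ≤ x × x + L < N
    advance x x<n eq eq′ with arc x
    ... | arc-low x<L = contradiction value λ ()
      where
      even : odd (x + L) ≡ false
      even = trans (odd-+ x L) (cong₂ _xor_ (proj₁ (base-false {N} {x} (trans (sym (low x<L)) eq))) (even-double (suc a)))
      below : x + L ≤ M
      below = s≤s⁻¹ (≤-trans (+-monoˡ-≤ L x<L) (≤-reflexive (sym suc-M)))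
      value : true ≡ false
      value with m≤n⇒m<n∨m≡n below
      ... | inj₁ x+L<M = trans (sym (trans (mid (m≤n+m L x) x+L<M) (cong not even)))
              (trans (sym (extend-≡ {N} {pattern′} (≤-trans x+L<M (≤-trans M≤N (n≤1+n N))))) eq′)
      ... | inj₂ x+L≡M = trans (sym odd-M) (trans (cong odd (sym x+L≡M)) even)
    ... | arc-mid L≤x x<M = contradiction (trans (sym (trans (high above) (base-odd {N} {x + L} isOdd)))
              (trans (sym (extend-≡ {N} {pattern′} x+L<n)) eq′)) λ ()
      where
      isOdd : odd (x + L) ≡ true
      isOdd = trans (odd-+ x L) (cong₂ _xor_ (not-injective (trans (sym (mid L≤x x<M)) eq)) (even-double (suc a)))
      above : M ≤ x + L
      above = ≤-trans (n≤1+n M) (≤-trans (≤-reflexive suc-M) (+-monoˡ-≤ L L≤x))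
      x+L<n : x + L < n
      x+L<n = <-trans (+-monoˡ-< L x<M) M+L<n
    ... | arc-high M≤x with <-≤-connex (x + L) n
    ...   | inj₁ x+L<n = M≤x , ≤∧≢⇒< (s≤s⁻¹ x+L<n) (proj₂ (base-false {N} {x + L}
              (trans (sym (high (≤-trans M≤x (m≤m+n x L)))) (trans (sym (extend-≡ {N} {pattern′} x+L<n)) eq′))))
    ...   | inj₂ n≤x+L with o , n+o≡ ← m≤n⇒∃[o]m+o≡n n≤x+L = contradiction
              (trans (sym (trans (odd-+ n o) (cong₂ _xor_ (cong not (even-double h)) (even-o o<L (value n+o≡)))))
                (trans (cong odd n+o≡) (trans (odd-+ x L) (cong₂ _xor_ even (even-double (suc a)))))) λ ()
      where
      even : odd x ≡ false
      even = proj₁ (base-false {N} {x} (trans (sym (high M≤x)) eq))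
      o<L : o < L
      o<L = +-cancelˡ-< n o L (≤-trans (s≤s (≤-reflexive n+o≡)) (+-monoˡ-≤ L x<n))
      value : ∀ {o} → n + o ≡ x + L → E o ≡ false
      value {o} n+o≡ = trans (sym (E-periodic o)) (trans (cong E (trans (+-comm o n) n+o≡)) eq′)
      even-o : ∀ {o} → o < L → E o ≡ false → odd o ≡ false
      even-o {o} o<L Eo = proj₁ (base-false {N} {o} (trans (sym (low o<L))
        (trans (sym (extend-≡ {N} {pattern′} (<-trans o<L (<-trans L<M (s≤s M≤N))))) Eo)))

  code : ℕ → Bool
  code p = E (L * p + 0)

  code-periodic : Periodic n code
  code-periodic = periodic-scale {f = λ i → E (i + 0)} (periodic-shift {f = E} E-periodic 0) L

  code-cover : Cover q code
  code-cover = cover-unit {n} {q} {L} {E} E-periodic unit pattern-cover 0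

  private
    regroup : ∀ y t L → y + t * L + L ≡ y + suc t * L
    regroup y t L = solve (y ∷ t ∷ L ∷ [])

    -- With q = 2 + p, a progression of q terms starting at M = 2L - 1 or later ends at (q + 1)L - 1
    -- or later, but N ≤ L q.
    too-long : ∀ {i} p → M ≤ i → i + p * L + L < N → n ≤ suc (L * (2 + p)) → ⊥
    too-long {i} p M≤i end<N n≤ = ≤-refute (suc (a * 2)) (+-mono-≤ (+-mono-≤ M≤i end<N) n≤)
      (((i + h * 2 + suc (suc a * 2 * (2 + p))) + suc (suc (a * 2)) ≡
        (suc ((suc a + a) * 2) + suc (i + p * (suc a * 2) + suc a * 2)) + suc (h * 2)) ∋ solve (i ∷ h ∷ a ∷ p ∷ []))

    no-false-progression : ∀ {i} → i < n → (∀ t → t < q → E (i + t * L) ≡ false) → ⊥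
    no-false-progression {i} i<n value = too-long p M≤i (proj₂ (track p (≤-reflexive 2+p≡q)))
        (subst (λ q → n ≤ suc (L * q)) (sym 2+p≡q) n≤)
      where
      p : ℕ
      p = proj₁ (m≤n⇒∃[o]m+o≡n 2≤q)
      2+p≡q : 2 + p ≡ q
      2+p≡q = proj₂ (m≤n⇒∃[o]m+o≡n 2≤q)
      advance-from : ∀ t → suc t < q → i + t * L < n → M ≤ i + t * L × i + t * L + L < N
      advance-from t t<q y<n = advance (i + t * L) y<n
        (trans (sym (extend-≡ {N} {pattern′} y<n)) (value t (<-trans (n<1+n t) t<q)))
        (trans (cong E (regroup i t L)) (value (suc t) t<q))
      track : ∀ t → suc t < q → M ≤ i + t * L × i + t * L + L < N
      track zero    1<q = advance-from 0 1<q (≤-trans (s≤s (≤-reflexive (+-identityʳ i))) i<n)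
      track (suc t) t<q = advance-from (suc t) t<q (≤-trans (s≤s (≤-reflexive (sym (regroup i t L))))
        (≤-trans (proj₂ (track t (<-trans (n<1+n _) t<q))) (n≤1+n N)))
      M≤i : M ≤ i
      M≤i = ≤-trans (proj₁ (track 0 2≤q)) (≤-reflexive (+-identityʳ i))

  code-no-gap : ∀ x → ¬ Gap q code x
  code-no-gap x gap = no-false-progression {(L * x) % n} (m%n<n (L * x) n) λ t t<q →
    trans (periodic-≈ {f = E} E-periodic {(L * x) % n + t * L} {L * (x + t) + 0}
      (≈-trans (+-congʳ-≈ (t * L) (%-≈ {n} (L * x))) (≡⇒≈ (distrib L t)))) (gap t t<q)
    where
    distrib : ∀ L t → L * x + t * L ≡ L * (x + t) + 0
    distrib L t = solve (L ∷ x ∷ t ∷ [])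

  -- Each pair (2i, 2i + 1) has one element, except (M - 1, M) at i = c, which has two. The adjacent
  -- pair (L - 1, L) straddles two of these pairs and adds nothing, and N is left over as one more
  -- element.
  code-count : count n code ≡ h + 2
  code-count = trans (count-unit {n} {q} {L} {e = E} E-periodic unit 0) (trans (extend-count {N} {pattern′})
    (trans (∑-last N (λ i → ⟦ pattern′ i ⟧)) (trans (cong₂ _+_ pairs (cong ⟦_⟧ (trans (high M≤N) (base-last N)))) (sym (+-suc h 1)))))
    where
    c<h : c < h
    c<h = *-cancelʳ-< 2 c h M≤N
    pair-≡1 : ∀ i → i < h → i ≢ c → pair pattern′ i ≡ 1
    pair-≡1 i i<h i≢c with <-≤-connex i (suc a) | <-≤-connex i c
    ... | inj₁ i≤a | _ = trans (cong₂ (λ b b′ → ⟦ b ⟧ + ⟦ b′ ⟧) (low (≤-trans (n≤1+n _) double)) (low double)) (base-pair {h} {i} i<h)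
      where
      double : suc (i * 2) < L
      double = *-mono-≤ i≤a (≤-refl {2})
    ... | inj₂ a<i | inj₁ i<c = cong₂ (λ b b′ → ⟦ b ⟧ + ⟦ b′ ⟧)
        (trans (mid L≤ (≤-trans (n≤1+n _) double)) (cong not (even-double i)))
        (trans (mid (≤-trans L≤ (n≤1+n _)) double) (cong (not ∘ not) (even-double i)))
      where
      L≤ : L ≤ i * 2
      L≤ = *-mono-≤ a<i (≤-refl {2})
      double : suc (i * 2) < M
      double = ≤-trans (*-mono-≤ i<c (≤-refl {2})) (n≤1+n _)
    ... | inj₂ _ | inj₂ c≤i = trans (cong₂ (λ b b′ → ⟦ b ⟧ + ⟦ b′ ⟧) (high above) (high (≤-trans above (n≤1+n _)))) (base-pair {h} {i} i<h)
      where
      above : M ≤ i * 2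
      above = ≤-trans (n≤1+n _) (*-mono-≤ (≤∧≢⇒< c≤i (i≢c ∘ sym)) (≤-refl {2}))
    pair-c : pair pattern′ c ≡ 2
    pair-c = cong₂ (λ b b′ → ⟦ b ⟧ + ⟦ b′ ⟧)
      (trans (mid (*-mono-≤ (m≤m+n (suc a) a) (≤-refl {2})) ≤-refl) (cong not (even-double c)))
      (trans (high ≤-refl) (base-odd {N} {M} odd-M))
    pairs : count N pattern′ ≡ suc h
    pairs with b , refl ← m≤n⇒∃[o]m+o≡n c<h = begin
      count N pattern′                                            ≡⟨ ∑-pairs h (λ i → ⟦ pattern′ i ⟧) ⟩
      ∑ h (pair pattern′)                                         ≡⟨ cong (λ m → ∑ m (pair pattern′)) (sym (+-suc c b)) ⟩
      ∑ (c + suc b) (pair pattern′)                               ≡⟨ ∑-split c (suc b) (pair pattern′) ⟩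
      ∑ c (pair pattern′) + (pair pattern′ (c + 0) + ∑ b (λ i → pair pattern′ (c + suc i)))
        ≡⟨ cong₂ _+_ (∑-cong c (λ i i<c → pair-≡1 i (<-trans i<c c<h) (<⇒≢ i<c)))
             (cong₂ _+_ (trans (cong (pair pattern′) (+-identityʳ c)) pair-c)
               (∑-cong b (λ i i<b → pair-≡1 (c + suc i) (s≤s (+-monoʳ-≤ c i<b)) (λ eq → m+1+n≢m c eq)))) ⟩
      ∑ c (λ _ → 1) + (2 + ∑ b (λ _ → 1))                         ≡⟨ cong₂ (λ x y → x + (2 + y)) (∑-const c 1) (∑-const b 1) ⟩
      c * 1 + (2 + b * 1)                                         ≡⟨ total c ⟩
      suc (suc c + b)                                             ∎
      where
      open ≡-Reasoning
      total : ∀ c → c * 1 + (2 + b * 1) ≡ suc (suc c + b)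
      total c = solve (c ∷ b ∷ [])

-- From periodic Boolean patterns to the minimum size of a code

Admissible : ℕ → ℕ → (ℕ → Bool) → Set
Admissible n q f = Periodic n f × Cover q f × UniqueGap n q f

Attained LowerBound : ℕ → ℕ → ℕ → Set
Attained   n q M = ∃ λ f → Admissible n q f × count n f ≡ M
LowerBound n q M = ∀ f → Admissible n q f → M ≤ count n f

minimum-code : ∀ {N r q M} → N ≡ 2 * r + q → 1 ≤ q → q ≤ r → Attained (suc N) q M → LowerBound (suc N) q M →
               IsMinICSize (CycleAdj (suc N)) r M
minimum-code {r = r} {q} {M} refl 1≤q q≤r (f , (per , cover , unique) , size) bound =
    (D , cover∧uniqueGap⇒identifying q≤r cover unique , trans (∣∣≡count D f char) size) , lower
  where
  open Cycle r q
  D : Subset n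
  D = tabulate (f ∘ toℕ)
  char : ∀ z → lookup D z ≡ f (toℕ z)
  char = lookup∘tabulate (f ∘ toℕ)
  open Code.Membership f per D char
  lower : ∀ D → IsIdentifyingCode Adj r D → M ≤ ∣ D ∣
  lower D ic = ≤-trans (bound fᴰ (perᴰ , Code.separating⇒cover fᴰ perᴰ 1≤q sepᴰ , Code.separating⇒uniqueGap fᴰ perᴰ sepᴰ))
      (≤-reflexive (sym (∣∣≡count D fᴰ charᴰ)))
    where
    fᴰ : ℕ → Bool
    fᴰ p = lookup D (p mod n)
    perᴰ : Periodic n fᴰ
    perᴰ p = cong (lookup D) (toℕ-injective (trans (toℕ-mod (p + n)) (trans ([m+n]%n≡m%n p n) (sym (toℕ-mod p)))))
    charᴰ : ∀ z → lookup D z ≡ fᴰ (toℕ z)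
    charᴰ z = cong (lookup D) (toℕ-injective (sym (trans (toℕ-mod (toℕ z)) (m<n⇒m%n≡m (toℕ<n z)))))
    sepᴰ : Code.Separating fᴰ perᴰ
    sepᴰ = Code.Membership.identifying⇒separating fᴰ perᴰ D charᴰ ic

-- Quotients and remainders in the exceptional cases

Exception : ℕ → ℕ → ℕ → ℕ → Set
Exception l m q n = (l % 2 ≡ 1 × m ≡ q ∸ 1 × 5 * q ≤ n) ⊎ (l % 2 ≡ 0 × m ≡ 1)

even-% : ∀ {l} → odd l ≡ false → l % 2 ≡ 0
even-% {l} even with parity l
... | inj₁ (_ , a , refl) = m*n%n≡0 a 2
... | inj₂ (isOdd , _) = contradiction (trans (sym isOdd) even) λ ()

odd-% : ∀ {l} → odd l ≡ true → l % 2 ≡ 1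
odd-% {l} isOdd with parity l
... | inj₁ (even , _) = contradiction (trans (sym isOdd) even) λ ()
... | inj₂ (_ , a , refl) = [m+kn]%n≡m%n 1 a 2

division-unique : ∀ {q l m l′ m′} → m < q → m′ < q → l * q + m ≡ l′ * q + m′ → l ≡ l′ × m ≡ m′
division-unique {q@(suc _)} {l} {m} {l′} {m′} m<q m′<q eq =
    *-cancelʳ-≡ l l′ q (+-cancelʳ-≡ m′ _ _ (trans (cong (l * q +_) (sym m≡m′)) eq)) , m≡m′
  where
  remainder : ∀ {l m} → m < q → (l * q + m) % q ≡ m
  remainder {l} {m} m<q = trans (cong (_% q) (+-comm (l * q) m)) (trans ([m+kn]%n≡m%n m l q) (m<n⇒m%n≡m m<q))
  m≡m′ : m ≡ m′
  m≡m′ = trans (sym (remainder {l} m<q)) (trans (cong (_% q) eq) (remainder {l′} m′<q))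

-- In the coordinate of Single, two gaps need 2 + (q − 1) w < n − 1, which forces w q = n ± 1.
unit-near-n : ∀ {N w p} → 3 ≤ p → w < suc N → 2 + p * w < N → Unit± (suc N) (suc p) w →
              (w * suc p ≡ suc (suc N)) ⊎ (suc (w * suc p) ≡ suc N)
unit-near-n {N} {w} {p} 3≤p w<n short unit = go unit
  where
  n = suc N
  2+wq<2n : 2 + w * suc p < n + n
  2+wq<2n = ≤-certificate 2 (+-mono-≤ w<n short) ((suc N + N + suc (2 + w * suc p) + 2 ≡ suc w + suc (2 + p * w) + (suc N + suc N))
      ∋ solve (N ∷ w ∷ p ∷ []))
  1<n : 1 < n
  1<n = s≤s (≤-trans (s≤s z≤n) (<⇒≤ short))
  remainder : ∀ {x b} → x < n + n → b < n → x ≈ b [mod n ] → x ≢ b → x ≡ n + b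
  remainder {x} {b} x<2n b<n e x≢b with <-≤-connex x n
  ... | inj₁ x<n = contradiction (≈⇒≡ x<n b<n e) x≢b
  ... | inj₂ n≤x with o , refl ← m≤n⇒∃[o]m+o≡n n≤x = cong (n +_) (≈⇒≡ (+-cancelˡ-< n o n x<2n) b<n
          (≈-trans (shift 1 0 ((o + 1 * suc N ≡ suc N + o + 0 * suc N) ∋ solve (o ∷ N ∷ []))) e))
  wq≢1 : ∀ w → w * suc p ≢ 1
  wq≢1 (suc w) eq = ≤-refute (2 + w * suc p) (+-mono-≤ 3≤p (≤-reflexive eq)) ((p + 1 + suc (2 + w * suc p) ≡ 3 + suc w * suc p)
      ∋ solve (p ∷ w ∷ []))
  go : Unit± n (suc p) w → (w * suc p ≡ suc n) ⊎ (suc (w * suc p) ≡ n)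
  go (inj₁ e) = inj₁ (trans (remainder (<-trans (n<1+n _) (<-trans (n<1+n _) 2+wq<2n)) 1<n e (wq≢1 w)) (+-comm n 1))
  go (inj₂ e) = inj₂ (trans (remainder (<-trans (n<1+n _) 2+wq<2n) z<s e λ ()) (+-identityʳ n))

long-gap⇒exception : ∀ {N w p l m} → 3 ≤ p → w < suc N → odd w ≡ false → 2 + p * w < N → Unit± (suc N) (suc p) w →
                     suc N ≡ l * suc p + m → m < suc p → Exception l m (suc p) (suc N)
long-gap⇒exception {N} {w} {p} {l} {m} 3≤p w<n even short unit n≡ m<q with unit-near-n {N} {w} {p} 3≤p w<n short unit
... | inj₂ wq+1≡n with refl , refl ← division-unique {suc p} {l} {m} {w} {1} m<q
      (s≤s (≤-trans (s≤s z≤n) 3≤p)) (trans (sym n≡) (trans (sym wq+1≡n) (+-comm 1 (w * suc p)))) =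
  inj₂ (even-% {w} even , refl)
... | inj₁ wq≡n+1 = plus w even wq≡n+1 5≤w
  where
  -- Subtracting 2 + p w < N from w (p + 1) = N + 2 leaves w ≥ 5. As w is even, w ≥ 6, and then n =
  -- w q - 1 ≥ 6q - 1 ≥ 5q.
  5≤w : 5 ≤ w
  5≤w = ≤-certificate 0 (+-mono-≤ short (≤-reflexive (sym wq≡n+1)))
    ((N + w * suc p + 5 + 0 ≡ suc (2 + p * w) + suc (suc N) + w) ∋ solve (N ∷ w ∷ p ∷ []))
  6≤ : ∀ {w} → odd w ≡ false → 5 ≤ w → 6 ≤ w
  6≤ even 5≤w with m≤n⇒m<n∨m≡n 5≤w
  ... | inj₁ 6≤w  = 6≤w
  ... | inj₂ refl = contradiction even λ ()
  plus : ∀ w → odd w ≡ false → w * suc p ≡ suc (suc N) → 5 ≤ w → Exception l m (suc p) (suc N)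
  plus w@(suc w′) even wq≡ 5≤w with refl , refl ← division-unique {suc p} {l} {m} {w′} {p} m<q ≤-refl (trans (sym n≡)
      (≡-certificate (sym wq≡) ((suc w′ * suc p + suc N ≡ suc (suc N) + (w′ * suc p + p)) ∋ solve (w′ ∷ p ∷ N ∷ [])))) =
    inj₁ (odd-% {w′} (not-injective even) , refl , ≤-certificate p (+-mono-≤ (*-mono-≤ (6≤ even 5≤w) (≤-refl {suc p})) (≤-reflexive wq≡))
      ((suc w′ * suc p + suc (suc N) + 5 * suc p + p ≡ 6 * suc p + suc w′ * suc p + suc N) ∋ solve (w′ ∷ p ∷ N ∷ [])))

exceptional-minimum : ∀ {k q} a → 4 ≤ q → 2 * q < suc (k * 2) →
                      (k ≡ suc a * q × 2 ≤ suc a) ⊎ (suc k ≡ suc a * q × 3 ≤ suc a) →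
                      Attained (suc (k * 2)) q (k + 2) × LowerBound (suc (k * 2)) q (k + 2)
exceptional-minimum {k} {q} a 4≤q 2q<n cases =
    (E.code , (E.code-periodic , E.code-cover , λ x _ gap _ → ⊥-elim (E.code-no-gap x gap)) , E.code-count) , lower cases
  where
  n = suc (k * 2)
  k≤ : (k ≡ suc a * q × 2 ≤ suc a) ⊎ (suc k ≡ suc a * q × 3 ≤ suc a) → k ≤ suc a * q
  k≤ (inj₁ (eq , _)) = ≤-reflexive eq
  k≤ (inj₂ (eq , _)) = ≤-trans (n≤1+n k) (≤-reflexive eq)
  ≤1+k : (k ≡ suc a * q × 2 ≤ suc a) ⊎ (suc k ≡ suc a * q × 3 ≤ suc a) → suc a * q ≤ suc k
  ≤1+k (inj₁ (eq , _)) = ≤-trans (≤-reflexive (sym eq)) (n≤1+n k)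
  ≤1+k (inj₂ (eq , _)) = ≤-reflexive (sym eq)
  -- The bound q ≥ 4 makes room for three arcs of length L = 2(a + 1) in the cycle.
  4a≤ : suc a * 4 ≤ suc k
  4a≤ = ≤-trans (*-mono-≤ (≤-refl {suc a}) 4≤q) (≤1+k cases)
  3L≤n : 3 * (suc a * 2) ≤ n
  3L≤n = ≤-certificate (suc (a * 2)) (+-mono-≤ 4a≤ 4a≤)
    ((suc k + suc k + 3 * (suc a * 2) + suc (a * 2) ≡ suc a * 4 + suc a * 4 + suc (k * 2)) ∋ solve (a ∷ k ∷ []))
  n≤ : n ≤ suc (suc a * 2 * q)
  n≤ = s≤s (≤-certificate 0 (+-mono-≤ (k≤ cases) (k≤ cases))
    ((suc a * q + suc a * q + k * 2 + 0 ≡ k + k + suc a * 2 * q) ∋ solve (a ∷ k ∷ q ∷ [])))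
  unit : (k ≡ suc a * q × 2 ≤ suc a) ⊎ (suc k ≡ suc a * q × 3 ≤ suc a) → Unit± n q (suc a * 2)
  unit (inj₁ (eq , _)) = inj₂ (shift 0 1 (≡-certificate (cong (_* 2) (sym eq))
    ((k * 2 + (suc (suc a * 2 * q) + 0 * suc (k * 2)) ≡ suc a * q * 2 + (0 + 1 * suc (k * 2))) ∋ solve (a ∷ q ∷ k ∷ []))))
  unit (inj₂ (eq , _)) = inj₁ (shift 0 1 (≡-certificate (cong (_* 2) (sym eq))
    ((suc k * 2 + (suc a * 2 * q + 0 * suc (k * 2)) ≡ suc a * q * 2 + (1 + 1 * suc (k * 2))) ∋ solve (a ∷ q ∷ k ∷ []))))
  module E = Exceptional a k q (≤-trans (s≤s (s≤s z≤n)) 4≤q) 3L≤n n≤ (unit cases)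
  0<2q : 0 < 2 * q
  0<2q = ≤-trans (≤-trans (s≤s z≤n) 4≤q) (m≤m+n q (q + 0))
  lower : (k ≡ suc a * q × 2 ≤ suc a) ⊎ (suc k ≡ suc a * q × 3 ≤ suc a) → LowerBound n q (k + 2)
  lower (inj₁ (eq , 2≤a)) f (per , cover , unique) = exceptional⁻ {k} {q} {f} per cover 0<2q 2q<n unique (suc a) 2≤a eq
  lower (inj₂ (eq , 3≤a)) f (per , cover , unique) = exceptional⁺ {k} {q} {f} per cover 0<2q 2q<n unique (suc a) 3≤a eq

-- For l = 2b + 1 and m = q - 1 one has n = 2(b + 1)q - 1, and 5q ≤ n forces b + 1 ≥ 3. For l = 2(a
-- + 1) and m = 1 one has n = 2(a + 1)q + 1, and l ≥ 3 forces a + 1 ≥ 2.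
exception-cases : ∀ {k q l m} → 1 ≤ q → 3 ≤ l → suc (k * 2) ≡ l * q + m → Exception l m q (suc (k * 2)) →
                  ∃ λ a → (k ≡ suc a * q × 2 ≤ suc a) ⊎ (suc k ≡ suc a * q × 3 ≤ suc a)
exception-cases {k} {suc p} {l} _ 3≤l n≡ (inj₁ (l-odd , refl , 5q≤n)) with parity l
... | inj₁ (even , _) = contradiction (trans (sym l-odd) (even-% {l} even)) λ ()
... | inj₂ (_ , b , refl) = b , inj₂ (1+k≡ , half-≤ {2} (<⇒≤ (*-cancelʳ-< (suc p) 5 (suc b * 2)
        (≤-trans (s≤s 5q≤n) (≤-reflexive (trans (cong (_* 2) 1+k≡) ((suc b * suc p * 2 ≡ suc b * 2 * suc p)
            ∋ solve (b ∷ p ∷ []))))))))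
  where
  1+k≡ : suc k ≡ suc b * suc p
  1+k≡ = *-cancelʳ-≡ (suc k) (suc b * suc p) 2 (≡-certificate n≡
    ((suc (b * 2) * suc p + p + suc k * 2 ≡ suc (k * 2) + suc b * suc p * 2) ∋ solve (b ∷ p ∷ k ∷ [])))
exception-cases {k} {q} {l} _ 3≤l n≡ (inj₂ (l-even , refl)) with parity l
... | inj₂ (isOdd , _) = contradiction (trans (sym l-even) (odd-% {l} isOdd)) λ ()
... | inj₁ (_ , zero , refl) = contradiction 3≤l λ ()
... | inj₁ (_ , suc a , refl) = a , inj₁ (*-cancelʳ-≡ k (suc a * q) 2 (≡-certificate n≡
    ((suc a * 2 * q + 1 + k * 2 ≡ suc (k * 2) + suc a * q * 2) ∋ solve (a ∷ q ∷ k ∷ []))) , half-≤ {1} 3≤l)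

-- Reduction by the gcd, and the value outside the exceptional cases

record GcdData (g q n : ℕ) : Set where
  constructor gcdData
  field
    q′ n′ x : ℕ
    q≡   : q ≡ q′ * g
    n≡   : n ≡ n′ * g
    unit : Unit± n′ q′ x

factor : ∀ g y m → g + y * (m * g) ≡ (1 + y * m) * g
factor g y m = solve (g ∷ y ∷ m ∷ [])

-- Bézout's identity over the naturals comes in two forms, according to which term carries the minus
-- sign. Dividing it by the gcd gives the two alternatives of `Unit±`.
gcd-data : ∀ q n → n ≢ 0 → GcdData (gcd q n) q n
gcd-data q n n≢0 with gcd q n in g≡ | gcd-GCD q n
... | zero | _ = contradiction (gcd[m,n]≡0⇒n≡0 q g≡) n≢0
... | g@(suc _) | GCD.is (divides q′ q≡ , divides n′ n≡) _ with Bézout.identity (subst (GCD q n) g≡ (gcd-GCD q n))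
...   | Bézout.Identity.+- x y eq = gcdData q′ n′ x q≡ n≡ (inj₁ (shift 0 y (trans (+-identityʳ _)
        (*-cancelʳ-≡ (x * q′) (1 + y * n′) g (trans (*-assoc x q′ g) (trans (cong (x *_) (sym q≡))
          (trans (sym eq) (trans (cong (λ n → g + y * n) n≡) (factor g y n′)))))))))
...   | Bézout.Identity.-+ x y eq = gcdData q′ n′ x q≡ n≡ (inj₂ (shift 0 y (trans (+-identityʳ _)
        (*-cancelʳ-≡ (suc (x * q′)) (y * n′) g (trans (sym (factor g x q′)) (trans (cong (λ q → g + x * q) (sym q≡))
          (trans eq (trans (cong (y *_) n≡) (sym (*-assoc y n′ g))))))))))

¬even-product : ∀ k b → suc (k * 2) ≢ b * 2
¬even-product k b eq = contradiction (trans (sym (cong not (even-double k))) (trans (cong odd eq) (even-double b))) λ ()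

generic-minimum : ∀ {k q d l m g} → g ≡ gcd q (suc (k * 2)) → 4 ≤ q → q ≡ d * 2 → suc (k * 2) ≡ l * q + m → m < q →
                  ¬ Exception l m q (suc (k * 2)) → ∃ λ h → suc (k * 2) ≡ suc (h * 2) * g ×
                  Attained (suc (k * 2)) q (g * suc h) × LowerBound (suc (k * 2)) q (g * suc h)
generic-minimum {k} {q} {d} {l} {m} {g} refl 4≤q q-even n≡lq+m m<q ordinary
  with gcdData q′ n′ x q≡ n≡ unit ← gcd-data q (suc (k * 2)) (λ ()) with parity n′
... | inj₁ (_ , b , refl) = contradiction (trans n≡ ((b * 2 * g ≡ b * g * 2) ∋ rearrange b g)) (¬even-product k (b * g))
  where
  rearrange : ∀ b g → b * 2 * g ≡ b * g * 2
  rearrange b g = solve (b ∷ g ∷ [])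
... | inj₂ (_ , h , refl) = h , n≡ , attained g refl , lower
  where
  n = suc (k * 2)
  inverse : ∃ λ v → q′ * v ≈ 1 [mod suc (h * 2) ]
  inverse = unit±-inverse {suc (h * 2)} {x} {q′} (comm unit)
    where
    comm : Unit± (suc (h * 2)) q′ x → Unit± (suc (h * 2)) x q′
    comm (inj₁ e) = inj₁ (≈-trans (≡⇒≈ (*-comm q′ x)) e)
    comm (inj₂ e) = inj₂ (≈-trans (≡⇒≈ (cong suc (*-comm q′ x))) e)
  lower : LowerBound n q (g * suc h)
  lower f (per , cover , _) = ≤-trans (cover-classes g h {q′} {proj₁ inverse} {f}
      (subst (λ n → Periodic n f) n≡ per) (subst (λ q → Cover q f) q≡ cover) (proj₂ inverse))
    (≤-reflexive (cong (λ n → count n f) (sym n≡)))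
  attained : ∀ c → c ≡ g → Attained n q (g * suc h)
  attained zero eq = contradiction (trans n≡ (trans (cong (suc (h * 2) *_) (sym eq)) (*-zeroʳ (suc (h * 2))))) λ ()
  attained (suc zero) eq = single (m≤n⇒∃[o]m+o≡n 4≤q)
    where
    q≡q′ : q ≡ q′
    q≡q′ = trans q≡ (trans (cong (q′ *_) (sym eq)) (*-identityʳ q′))
    k≡h : k ≡ h
    k≡h = *-cancelʳ-≡ k h 2 (suc-injective (trans n≡ (trans (cong (suc (h * 2) *_) (sym eq)) (*-identityʳ (suc (h * 2))))))
    unit-k : Unit± n q x
    unit-k = subst₂ (λ h q → Unit± (suc (h * 2)) q x) (sym k≡h) (sym q≡q′) unit
    single : (∃ λ o → 4 + o ≡ q) → Attained n q (g * suc h)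
    single (o , 4+o≡q) with w , w<n , even , unit-w ← even-unit {k} {q} {x} unit-k =
      S.code , (S.code-periodic , S.code-cover , S.code-uniqueGap p (sym 4+o≡q) (λ short → ordinary (subst (λ q → Exception l m q n) 4+o≡q
        (long-gap⇒exception {k * 2} {w} {p} {l} {m} (s≤s (s≤s (s≤s z≤n))) w<n even short
          (subst (λ q → Unit± n q w) (sym 4+o≡q) unit-w)
          (subst (λ q → n ≡ l * q + m) (sym 4+o≡q) n≡lq+m) (subst (m <_) (sym 4+o≡q) m<q))))) ,
      trans S.code-count (trans (cong suc k≡h) (trans (sym (*-identityˡ (suc h))) (cong (_* suc h) eq)))
      where
      module S = Single k q w even w<n unit-w
      p = 3 + o
  attained (suc (suc c)) eq = subst₂ (λ n q → Attained n q (g * suc h))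
      (trans (cong (suc (h * 2) *_) eq) (sym n≡)) (trans (cong (q′ *_) eq) (sym q≡))
      (C.code , (C.code-periodic , C.code-cover , λ a _ gap _ → ⊥-elim (C.code-no-gap a gap)) , trans C.code-count (cong (_* suc h) eq))
    where
    -- If q′ were 1, the even number q = g would divide the odd number n.
    2≤ : ∀ {q′} → q ≡ q′ * g → 2 ≤ q′
    2≤ {zero} q≡ = contradiction (subst (4 ≤_) q≡ 4≤q) λ ()
    2≤ {suc zero} q≡ = contradiction (trans n≡ (trans (cong (suc (h * 2) *_) (trans (sym (*-identityˡ g)) (trans (sym q≡) q-even)))
      (sym (*-assoc (suc (h * 2)) d 2)))) (¬even-product k (suc (h * 2) * d))
    2≤ {suc (suc _)} _ = s≤s (s≤s z≤n)
    module C = Classes (suc (suc c)) h q′ x (s≤s (s≤s z≤n)) (2≤ q≡) unit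

-- With the rounding term 2g - 1 added, the numerator equals (g - 1) + (h + 1)(2g), and g - 1 < 2g.
ceilDiv-odd : ∀ h g → 1 ≤ g → ceilDiv (suc (h * 2) * g) (2 * g) ≡ suc h
ceilDiv-odd h (suc g) _ = trans (cong (_/ (2 * suc g)) ((suc (h * 2) * suc g + (g + suc (g + 0)) ≡ g + suc h * (2 * suc g))
    ∋ solve (h ∷ g ∷ [])))
  (trans (+-distrib-/-∣ʳ g (divides (suc h) refl))
    (cong₂ _+_ (m<n⇒m/n≡0 (≤-trans (n<1+n g) (m≤m+n (suc g) (suc g + 0)))) (m*n/n≡m (suc h) (2 * suc g))))

theorem7 : (r k l m : ℕ) → 1 ≤ r → 2 * r + 5 ≤ 2 * k + 1 → 2 * k + 1 ≤ 3 * r + 1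
    → 2 * k + 1 ≡ l * (2 * k ∸ 2 * r) + m → 3 ≤ l → m < 2 * k ∸ 2 * r
    → (((l % 2 ≡ 1 × m ≡ (2 * k ∸ 2 * r) ∸ 1 × 5 * (2 * k ∸ 2 * r) ≤ 2 * k + 1) ⊎ (l % 2 ≡ 0 × m ≡ 1))
    → IsMinICSize (CycleAdj (suc (2 * k))) r (k + 2))
    × (¬ ((l % 2 ≡ 1 × m ≡ (2 * k ∸ 2 * r) ∸ 1 × 5 * (2 * k ∸ 2 * r) ≤ 2 * k + 1) ⊎ (l % 2 ≡ 0 × m ≡ 1))
    → IsMinICSize (CycleAdj (suc (2 * k))) r
    (gcd (2 * k ∸ 2 * r) (2 * k + 1) * ceilDiv (2 * k + 1) (2 * gcd (2 * k ∸ 2 * r) (2 * k + 1))))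
theorem7 r k l m _ low high n≡lq+m 3≤l m<q = exceptional , ordinary
  where
  q g : ℕ
  q = 2 * k ∸ 2 * r
  g = gcd q (2 * k + 1)
  n≡ : 2 * k + 1 ≡ suc (k * 2)
  n≡ = trans (+-comm (2 * k) 1) (cong suc (*-comm 2 k))
  2r≤2k : 2 * r ≤ 2 * k
  2r≤2k = ≤-certificate 4 low ((2 * k + 1 + 2 * r + 4 ≡ 2 * r + 5 + 2 * k) ∋ solve (r ∷ k ∷ []))
  2r+q≡2k : 2 * r + q ≡ 2 * k
  2r+q≡2k = m+[n∸m]≡n 2r≤2k
  2r+q≤2k : 2 * r + q ≤ 2 * k
  2r+q≤2k = ≤-reflexive 2r+q≡2k
  q-even : q ≡ (k ∸ r) * 2
  q-even = trans (sym (*-distribˡ-∸ 2 k r)) (*-comm 2 (k ∸ r))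
  4≤q : 4 ≤ q
  4≤q = bound q (≤-reflexive (sym 2r+q≡2k))
    where
    bound : ∀ q → 2 * k ≤ 2 * r + q → 4 ≤ q
    bound q le = ≤-certificate 0 (+-mono-≤ low le) ((2 * k + 1 + (2 * r + q) + 4 + 0 ≡ 2 * r + 5 + 2 * k + q)
        ∋ solve (r ∷ k ∷ q ∷ []))
  1≤q : 1 ≤ q
  1≤q = ≤-trans (s≤s z≤n) 4≤q
  q≤r : q ≤ r
  q≤r = bound q 2r+q≤2k
    where
    bound : ∀ q → 2 * r + q ≤ 2 * k → q ≤ r
    bound q le = ≤-certificate 0 (+-mono-≤ high le) ((3 * r + 1 + 2 * k + q + 0 ≡ 2 * k + 1 + (2 * r + q) + r)
        ∋ solve (r ∷ k ∷ q ∷ []))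
  2q<n : 2 * q < suc (k * 2)
  2q<n = s≤s (≤-trans (*-mono-≤ (≤-refl {2}) q≤r) (≤-trans 2r≤2k (≤-reflexive (*-comm 2 k))))
  minimum : ∀ {M} → Attained (suc (k * 2)) q M × LowerBound (suc (k * 2)) q M → IsMinICSize (CycleAdj (suc (2 * k))) r M
  minimum {M} (attained , bound) = subst (λ N → IsMinICSize (CycleAdj (suc N)) r M) (*-comm k 2)
    (minimum-code (trans (*-comm k 2) (sym 2r+q≡2k)) 1≤q q≤r attained bound)
  exceptional : Exception l m q (2 * k + 1) → IsMinICSize (CycleAdj (suc (2 * k))) r (k + 2)
  exceptional exception with a , cases ← exception-cases {k} {q} {l} {m} 1≤q 3≤l
                                      (trans (sym n≡) n≡lq+m) (subst (Exception l m q) n≡ exception) =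
    minimum (exceptional-minimum {k} {q} a 4≤q 2q<n cases)
  ordinary : ¬ Exception l m q (2 * k + 1) → IsMinICSize (CycleAdj (suc (2 * k))) r (g * ceilDiv (2 * k + 1) (2 * g))
  ordinary ¬exception with h , n≡n′g , bounds ← generic-minimum {k} {q} {k ∸ r} {l} {m} {g} (cong (gcd q) n≡) 4≤q q-even
                             (trans (sym n≡) n≡lq+m) m<q (λ exception → ¬exception (subst (Exception l m q) (sym n≡) exception)) =
    subst (IsMinICSize (CycleAdj (suc (2 * k))) r) (cong (g *_) size) (minimum bounds)
    where
    1≤g : 1 ≤ g
    1≤g = n≢0⇒n>0 (λ g≡0 → contradiction (trans n≡n′g (trans (cong (suc (h * 2) *_) g≡0) (*-zeroʳ (suc (h * 2))))) λ ())
    size : suc h ≡ ceilDiv (2 * k + 1) (2 * g)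
    size = sym (trans (cong (λ n → ceilDiv n (2 * g)) (trans n≡ n≡n′g)) (ceilDiv-odd h g 1≤g))
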